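{- Let $A\subseteq\mathbb{R}$ be a finite convex set. Then \[ |A+A|\geq |A|^{30/19-o(1)}\,. \]
   Context: A finite set $A=\{a_1<a_2<\dots<a_n\}\subseteq\mathbb{R}$ is called convex if the sequence of consecutive differences $a_{i+1}-a_i$, $i=1,\dots,n-1$, is strictly increasing. $A+A=\{a+b:a,b\in A\}$. The term $o(1)$ denotes a quantity tending to $0$ as $|A|\to\infty$ (uniformly over all such sets). -}

module Defs where

open import Level using (Level; _⊔_; suc)
open import Data.Nat using (ℕ) renaming (suc to sucℕ; _<_ to _<ℕ_)
open import Data.Fin using (Fin; toℕ)
open import Data.Product using (Σ; ∃; _×_)
open import Data.Sum using (_⊎_)
open import Relation.Nullary using (¬_)
open import Relation.Binary.PropositionalEquality using (_≡_)
open import Algebra.Structures using (IsCommutativeRing)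
open import Relation.Binary.Structures using (IsStrictPartialOrder)

-- A complete ordered field (the axioms characterising ℝ up to isomorphism).
-- The real numbers are not available in agda-stdlib, so the theorem is
-- quantified over every structure satisfying these axioms.
record RealField (c ℓ : Level) : Set (suc (c ⊔ ℓ)) where
  infix  4 _≈_ _<_ _≤_
  infixl 6 _+_ _-_
  infixl 7 _*_
  field
    Carrier : Set c
    _≈_     : Carrier → Carrier → Set ℓ
    _+_     : Carrier → Carrier → Carrier
    _*_     : Carrier → Carrier → Carrier
    -_      : Carrier → Carrier
    0#      : Carrier
    1#      : Carrier
    _<_     : Carrier → Carrier → Set ℓ
    isCommutativeRing : IsCommutativeRing _≈_ _+_ _*_ -_ 0# 1#
    0≉1     : ¬ (0# ≈ 1#)
    inverse : ∀ x → ¬ (x ≈ 0#) → Σ Carrier (λ y → x * y ≈ 1#)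
    isStrictPartialOrder : IsStrictPartialOrder _≈_ _<_
    connected : ∀ x y → ¬ (x ≈ y) → (x < y) ⊎ (y < x)
    +-mono-< : ∀ {x y} z → x < y → x + z < y + z
    *-pos    : ∀ {x y} → 0# < x → 0# < y → 0# < x * y

  _-_ : Carrier → Carrier → Carrier
  x - y = x + (- y)

  _≤_ : Carrier → Carrier → Set ℓ
  x ≤ y = (x < y) ⊎ (x ≈ y)

  IsUpperBound : (Carrier → Set (c ⊔ ℓ)) → Carrier → Set (c ⊔ ℓ)
  IsUpperBound P b = ∀ x → P x → x ≤ b

  field
    completeness : (P : Carrier → Set (c ⊔ ℓ)) → ∃ P → ∃ (IsUpperBound P) →
                   Σ Carrier (λ s → IsUpperBound P s × (∀ b → IsUpperBound P b → s ≤ b))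

module _ {c ℓ : Level} (R : RealField c ℓ) where
  open RealField R

  -- a : Fin n → Carrier enumerates A = {a_0 < a_1 < ... < a_{n-1}} and A is convex:
  -- consecutive differences are strictly increasing.
  Convex : (n : ℕ) → (Fin n → Carrier) → Set ℓ
  Convex n a =
    (∀ (i j : Fin n) → toℕ i <ℕ toℕ j → a i < a j) ×
    (∀ (i j k : Fin n) → toℕ j ≡ sucℕ (toℕ i) → toℕ k ≡ sucℕ (toℕ j) →
       a j - a i < a k - a j)

{-# OPTIONS --safe #-}

-- Write r for the number of representations of a difference in A − A. For a convex set A of size n an elementary
-- incidence bound replaces the Szemerédi–Trotter theorem: at most O(n m² / t³) numbers have t representations as
-- a − b with a ∈ A and b in a given set of size m. In particular ∑ r³ ≤ n³ up to logarithms.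
--
-- Let s = |A + A| and let P be the set of popular sums, those with at least n² / 8s representations. Half of the elements
-- b of A have a + b ∈ P for most a; on these A′ ⊆ A the additive energy is ≥ n⁴ / s, and some dyadic level τ of r carries
-- it, with w pairs (b , c) whose difference lies in D = {r ≥ τ}: τ w ≥ n⁴ / s and τ² w ≤ n³.
--
-- Sending (a , b , c) to (a + b , a + c) and applying Cauchy–Schwarz gives n² w² ≤ n³ Q, where Q counts the pairs of P
-- whose difference lies in D. Representing one member of each pair as a sum in A + A bounds (n² / s) Q by the number of
-- solutions of a + b = y + d with y ∈ P and d ∈ D, that is by ∑ₜ f(t) g(t) with f = r_{A−P} and g = r_{D−A}. The
-- incidence bound for f and g together with ∑ g = n |D| gives (∑ f g)⁶ ≤ n⁶ s⁴ |D|⁵, and |D| τ ≤ w. Eliminating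
-- τ, w, Q and |D| yields n³⁰ ≤ s¹⁹ up to logarithms.
module Submission where

open import Defs
open import Level using (Level; 0ℓ)
open import Algebra.Bundles using (CommutativeRing)
open import Function.Base using (_∘_; id; case_of_)
open import Data.Empty using (⊥-elim)
open import Data.Fin using (Fin; toℕ; fromℕ<)
open import Data.Fin.Properties using (toℕ-injective; toℕ-fromℕ<; toℕ<n)
open import Data.List using (List; []; _∷_; _++_; length; map; filter; upTo; cartesianProduct; allFin; deduplicate)
open import Data.List.Membership.Propositional using (_∈_; find; lose)
open import Data.List.Membership.Propositional.Properties
  using (∈-upTo⁺; ∈-filter⁻; ∈-filter⁺; ∈-map⁺; ∈-map⁻; ∈-cartesianProduct⁻; ∈-cartesianProduct⁺)
open import Data.List.Properties
  using (length-upTo; length-++; length-map; length-tabulate; length-deduplicate; length-filter)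
open import Data.List.Relation.Unary.All as All using ([]; _∷_)
import Data.List.Relation.Unary.All.Properties as All
open import Data.List.Relation.Unary.AllPairs as AllPairs using (AllPairs; []; _∷_)
import Data.List.Relation.Unary.AllPairs.Properties as AllPairs
open import Data.List.Relation.Unary.Any as Any using (Any; here; there; any?)
import Data.List.Relation.Unary.Any.Properties as Any
open import Data.List.Relation.Unary.Unique.DecSetoid.Properties using (deduplicate-!)
open import Data.List.Relation.Unary.Unique.Propositional.Properties using (allFin⁺)
open import Data.Nat
open import Data.Nat.DivMod
open import Data.Nat.Properties
open import Data.Nat.Solver using (module +-*-Solver)
open import Data.Nat.Tactic.RingSolver using (solve-∀)
open import Data.Product using (Σ; ∃; _×_; _,_; proj₁; proj₂)
open import Data.Sum using (_⊎_; inj₁; inj₂)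
open import Relation.Binary.Bundles using (DecSetoid)
open import Relation.Binary.Definitions using (tri<; tri≈; tri>)
open import Relation.Binary.PropositionalEquality
open import Relation.Binary.Structures using (IsStrictPartialOrder)
open import Relation.Nullary using (¬_; Dec; yes; no; contradiction)
open import Relation.Nullary.Decidable using (_×-dec_; ¬?)
open import Relation.Unary using (Decidable)

open +-*-Solver using (_:*_; _:^_; _:=_)

-- Finite sums of natural numbers over lists, and counting with them.

module FiniteSums where

  private
    variable
      x y p : Level
      X : Set x
      Y : Set y
      P : Set p

  𝟙 : Dec P → ℕ
  𝟙 (yes _) = 1
  𝟙 (no  _) = 0

  𝟙≤1 : (d : Dec P) → 𝟙 d ≤ 1
  𝟙≤1 (yes _) = ≤-refl
  𝟙≤1 (no _)  = z≤n

  𝟙≥1 : (d : Dec P) → P → 1 ≤ 𝟙 d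
  𝟙≥1 (yes _) _ = ≤-refl
  𝟙≥1 (no ¬p) p = contradiction p ¬p

  𝟙>0⇒ : (d : Dec P) → 0 < 𝟙 d → P
  𝟙>0⇒ (yes p) _ = p

  𝟙*≤ : (d : Dec P) {m n : ℕ} → (P → m ≤ n) → 𝟙 d * m ≤ n
  𝟙*≤ (yes p) {m} h = ≤-trans (≤-reflexive (+-identityʳ m)) (h p)
  𝟙*≤ (no _)      h = z≤n

  𝟙≤ : (d : Dec P) {n : ℕ} → (P → 1 ≤ n) → 𝟙 d ≤ n
  𝟙≤ (yes p) h = h p
  𝟙≤ (no _)  h = z≤n

  ≤𝟙* : (d : Dec P) {m : ℕ} → P → m ≤ 𝟙 d * m
  ≤𝟙* (yes _) {m} _ = ≤-reflexive (sym (+-identityʳ m))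
  ≤𝟙* (no ¬p)     p = contradiction p ¬p

  1≤𝟙+𝟙¬ : ∀ {P : Set} (d : Dec P) → 1 ≤ 𝟙 d + 𝟙 (¬? d)
  1≤𝟙+𝟙¬ (yes _) = ≤-refl
  1≤𝟙+𝟙¬ (no _)  = ≤-refl

  1≤+𝟙¬+𝟙¬ : ∀ {P Q : Set} (d : Dec P) (e : Dec Q) {h : ℕ} → (P → Q → 1 ≤ h) → 1 ≤ h + (𝟙 (¬? d) + 𝟙 (¬? e))
  1≤+𝟙¬+𝟙¬ (yes p) (yes q) f = ≤-trans (f p q) (m≤m+n _ _)
  1≤+𝟙¬+𝟙¬ (yes _) (no _)  f = m≤n+m _ _
  1≤+𝟙¬+𝟙¬ (no _)  e       f = ≤-trans (s≤s z≤n) (m≤n+m _ _)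

  ∑ : List X → (X → ℕ) → ℕ
  ∑ []       f = 0
  ∑ (x ∷ xs) f = f x + ∑ xs f

  infixr 8 ∑
  syntax ∑ xs (λ x → e) = ∑[ x ∈ xs ] e

  ∑-mono-∈ : (xs : List X) {f g : X → ℕ} → (∀ x → x ∈ xs → f x ≤ g x) → ∑ xs f ≤ ∑ xs g
  ∑-mono-∈ []       h = z≤n
  ∑-mono-∈ (x ∷ xs) h = +-mono-≤ (h x (here refl)) (∑-mono-∈ xs (λ y → h y ∘ there))

  ∑-mono : (xs : List X) {f g : X → ℕ} → (∀ x → f x ≤ g x) → ∑ xs f ≤ ∑ xs g
  ∑-mono xs h = ∑-mono-∈ xs (λ x _ → h x)

  ∑-cong : (xs : List X) {f g : X → ℕ} → (∀ x → f x ≡ g x) → ∑ xs f ≡ ∑ xs g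
  ∑-cong []       h = refl
  ∑-cong (x ∷ xs) h = cong₂ _+_ (h x) (∑-cong xs h)

  ∑-zero : (xs : List X) → ∑ xs (λ _ → 0) ≡ 0
  ∑-zero []       = refl
  ∑-zero (x ∷ xs) = ∑-zero xs

  ∑-const : (xs : List X) (c : ℕ) → ∑ xs (λ _ → c) ≡ length xs * c
  ∑-const []       c = refl
  ∑-const (x ∷ xs) c = cong (c +_) (∑-const xs c)

  ∑-≤-const : (xs : List X) {f : X → ℕ} (c : ℕ) → (∀ x → f x ≤ c) → ∑ xs f ≤ length xs * c
  ∑-≤-const xs c h = ≤-trans (∑-mono xs h) (≤-reflexive (∑-const xs c))

  ∑-+ : (xs : List X) (f g : X → ℕ) → ∑[ x ∈ xs ] (f x + g x) ≡ ∑ xs f + ∑ xs g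
  ∑-+ []       f g = refl
  ∑-+ (x ∷ xs) f g = trans (cong (f x + g x +_) (∑-+ xs f g)) (interchange (f x) (g x) (∑ xs f) (∑ xs g))
    where
    interchange : ∀ a b c d → a + b + (c + d) ≡ a + c + (b + d)
    interchange = solve-∀

  ∑-*ˡ : (xs : List X) (c : ℕ) (f : X → ℕ) → ∑[ x ∈ xs ] (c * f x) ≡ c * ∑ xs f
  ∑-*ˡ []       c f = sym (*-zeroʳ c)
  ∑-*ˡ (x ∷ xs) c f = trans (cong (c * f x +_) (∑-*ˡ xs c f)) (sym (*-distribˡ-+ c (f x) (∑ xs f)))

  ∑-*ʳ : (xs : List X) (c : ℕ) (f : X → ℕ) → ∑[ x ∈ xs ] (f x * c) ≡ ∑ xs f * c
  ∑-*ʳ xs c f = trans (∑-cong xs (λ x → *-comm (f x) c)) (trans (∑-*ˡ xs c f) (*-comm c (∑ xs f)))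

  ∑-swap : (xs : List X) (ys : List Y) (f : X → Y → ℕ) →
           ∑[ x ∈ xs ] ∑[ y ∈ ys ] f x y ≡ ∑[ y ∈ ys ] ∑[ x ∈ xs ] f x y
  ∑-swap []       ys f = sym (∑-zero ys)
  ∑-swap (x ∷ xs) ys f = trans (cong (∑ ys (f x) +_) (∑-swap xs ys f))
                               (sym (∑-+ ys (f x) (λ y → ∑[ x ∈ xs ] f x y)))

  ∑-++ : (xs ys : List X) (f : X → ℕ) → ∑ (xs ++ ys) f ≡ ∑ xs f + ∑ ys f
  ∑-++ []       ys f = refl
  ∑-++ (x ∷ xs) ys f = trans (cong (f x +_) (∑-++ xs ys f)) (sym (+-assoc (f x) _ _))

  ∑-map : (xs : List X) (g : X → Y) (f : Y → ℕ) → ∑ (map g xs) f ≡ ∑ xs (f ∘ g)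
  ∑-map []       g f = refl
  ∑-map (x ∷ xs) g f = cong (f (g x) +_) (∑-map xs g f)

  ∑-× : (xs : List X) (ys : List Y) (f : X × Y → ℕ) →
        ∑ (cartesianProduct xs ys) f ≡ ∑[ x ∈ xs ] ∑[ y ∈ ys ] f (x , y)
  ∑-× []       ys f = refl
  ∑-× (x ∷ xs) ys f = trans (∑-++ (map (x ,_) ys) (cartesianProduct xs ys) f)
                            (cong₂ _+_ (∑-map ys (x ,_) f) (∑-× xs ys f))

  length-× : (xs : List X) (ys : List Y) → length (cartesianProduct xs ys) ≡ length xs * length ys
  length-× []       ys = refl
  length-× (x ∷ xs) ys = trans (length-++ (map (x ,_) ys)) (cong₂ _+_ (length-map (x ,_) ys) (length-× xs ys))

  ∑*∑ : (xs : List X) (ys : List Y) (f : X → ℕ) (g : Y → ℕ) →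
        ∑ xs f * ∑ ys g ≡ ∑[ x ∈ xs ] ∑[ y ∈ ys ] (f x * g y)
  ∑*∑ xs ys f g = trans (sym (∑-*ʳ xs (∑ ys g) f)) (∑-cong xs (λ x → sym (∑-*ˡ ys (f x) g)))

  ∑-filter : {P : X → Set p} (P? : Decidable P) (xs : List X) (f : X → ℕ) →
             ∑ (filter P? xs) f ≡ ∑[ x ∈ xs ] (𝟙 (P? x) * f x)
  ∑-filter P? []       f = refl
  ∑-filter P? (x ∷ xs) f with P? x
  ... | yes _ = cong₂ _+_ (sym (+-identityʳ (f x))) (∑-filter P? xs f)
  ... | no  _ = ∑-filter P? xs f

  length-as-∑ : (xs : List X) → length xs ≡ ∑[ _ ∈ xs ] 1
  length-as-∑ xs = sym (trans (∑-const xs 1) (*-identityʳ _))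

  length-filter-∑ : {P : X → Set p} (P? : Decidable P) (xs : List X) →
                    length (filter P? xs) ≡ ∑[ x ∈ xs ] 𝟙 (P? x)
  length-filter-∑ P? xs = trans (length-as-∑ (filter P? xs))
    (trans (∑-filter P? xs (λ _ → 1)) (∑-cong xs (λ x → *-identityʳ _)))

  term≤∑ : {xs : List X} (f : X → ℕ) {x : X} → x ∈ xs → f x ≤ ∑ xs f
  term≤∑ f (here refl) = m≤m+n _ _
  term≤∑ f (there x∈)  = ≤-trans (term≤∑ f x∈) (m≤n+m _ _)

  any⇒∑≥1 : {xs : List X} (f : X → ℕ) → Any (λ x → 1 ≤ f x) xs → 1 ≤ ∑ xs f
  any⇒∑≥1 f (here h)  = ≤-trans h (m≤m+n _ _)
  any⇒∑≥1 f (there h) = ≤-trans (any⇒∑≥1 f h) (m≤n+m _ _)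

  ∑>0⇒∃ : (xs : List X) {f : X → ℕ} → 0 < ∑ xs f → ∃ λ x → x ∈ xs × 0 < f x
  ∑>0⇒∃ (x ∷ xs) {f} h with f x in eq
  ... | suc k = x , here refl , subst (0 <_) (sym eq) z<s
  ... | zero  = let (y , y∈ , fy) = ∑>0⇒∃ xs h in y , there y∈ , fy

  -- Two positive terms would stand at different places of a list of pairwise unrelated elements and
  -- yet be related. The relation is arbitrary because the lemma serves indices under `≡`, reals
  -- under `≈`, and keys.
  ∑≤1 : {_~_ : X → X → Set p} {xs : List X} {f : X → ℕ} → AllPairs (λ x y → ¬ (x ~ y)) xs →
        (∀ x → x ∈ xs → f x ≤ 1) →
        (∀ x y → x ∈ xs → y ∈ xs → 0 < f x → 0 < f y → x ~ y) → ∑ xs f ≤ 1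
  ∑≤1 []                         _ _ = z≤n
  ∑≤1 {xs = x ∷ xs} {f} (x≁ ∷ u) b h with f x in eq
  ... | zero  = ∑≤1 u (λ y → b y ∘ there) (λ y z y∈ z∈ → h y z (there y∈) (there z∈))
  ... | suc k with ∑ xs f in eq′
  ...   | zero  = ≤-trans (≤-reflexive (trans (+-identityʳ _) (sym eq))) (b x (here refl))
  ...   | suc m with ∑>0⇒∃ xs (subst (0 <_) (sym eq′) z<s)
  ...     | y , y∈ , fy = ⊥-elim (All.lookup x≁ y∈ (h x y (here refl) (there y∈) (subst (0 <_) (sym eq) z<s) fy))

  -- The pigeonhole step: it singles out one dyadic level and loses only the number of levels.
  ∑≤length*max : (xs : List X) (f : X → ℕ) → 0 < length xs →
                 ∃ λ x → x ∈ xs × ∑ xs f ≤ length xs * f x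
  ∑≤length*max (x ∷ [])      f _ = x , here refl , ≤-refl
  ∑≤length*max (x ∷ y ∷ xs) f _ with ∑≤length*max (y ∷ xs) f z<s
  ... | z , z∈ , h with ≤-total (f x) (f z)
  ...   | inj₁ le = z , there z∈ , +-mono-≤ le h
  ...   | inj₂ ge = x , here refl , +-monoʳ-≤ (f x) (≤-trans h (*-monoʳ-≤ (suc (length xs)) ge))

  2ab≤a²+b² : ∀ a b → 2 * (a * b) ≤ a * a + b * b
  2ab≤a²+b² a b with ≤-total a b
  ... | inj₁ h with k , refl ← m≤n⇒∃[o]m+o≡n h = ≤-trans (m≤m+n _ (k * k)) (≤-reflexive (lem a k))
    where
    lem : ∀ a k → 2 * (a * (a + k)) + k * k ≡ a * a + (a + k) * (a + k)
    lem = solve-∀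
  ... | inj₂ h with k , refl ← m≤n⇒∃[o]m+o≡n h = ≤-trans (m≤m+n _ (k * k)) (≤-reflexive (lem b k))
    where
    lem : ∀ b k → 2 * ((b + k) * b) + k * k ≡ (b + k) * (b + k) + b * b
    lem = solve-∀

  -- Both squares are expanded into double sums and doubled; then 2 (ad)(cb) ≤ (ad)² + (cb)² applies
  -- to each pair of terms, and the two halves of the result are equal by symmetry.
  cauchySchwarz : (xs : List X) (f g : X → ℕ) →
    ∑[ x ∈ xs ] (f x * g x) * ∑[ x ∈ xs ] (f x * g x) ≤
    ∑[ x ∈ xs ] (f x * f x) * ∑[ x ∈ xs ] (g x * g x)
  cauchySchwarz xs f g = *-cancelˡ-≤ 2 (begin
    2 * (∑ xs fg * ∑ xs fg)
      ≡⟨ cong (2 *_) (∑*∑ xs xs fg fg) ⟩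
    2 * ∑[ x ∈ xs ] ∑[ y ∈ xs ] (fg x * fg y)
      ≡⟨ trans (sym (∑-*ˡ xs 2 _)) (∑-cong xs (λ x → sym (∑-*ˡ xs 2 _))) ⟩
    ∑[ x ∈ xs ] ∑[ y ∈ xs ] (2 * (fg x * fg y))
      ≤⟨ ∑-mono xs (λ x → ∑-mono xs (λ y → pointwise (f x) (g x) (f y) (g y))) ⟩
    ∑[ x ∈ xs ] ∑[ y ∈ xs ] (ff x * gg y + ff y * gg x)
      ≡⟨ trans (∑-cong xs (λ x → ∑-+ xs _ _)) (∑-+ xs _ _) ⟩
    ∑[ x ∈ xs ] ∑[ y ∈ xs ] (ff x * gg y) + ∑[ x ∈ xs ] ∑[ y ∈ xs ] (ff y * gg x)
      ≡⟨ cong₂ _+_ (sym (∑*∑ xs xs ff gg)) (trans (∑-swap xs xs (λ x y → ff y * gg x)) (sym (∑*∑ xs xs ff gg))) ⟩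
    ∑ xs ff * ∑ xs gg + ∑ xs ff * ∑ xs gg
      ≡⟨ cong (∑ xs ff * ∑ xs gg +_) (sym (+-identityʳ _)) ⟩
    2 * (∑ xs ff * ∑ xs gg) ∎)
    where
    open ≤-Reasoning
    fg ff gg : _ → ℕ
    fg x = f x * g x
    ff x = f x * f x
    gg x = g x * g x
    pointwise : ∀ a b c d → 2 * (a * b * (c * d)) ≤ a * a * (d * d) + c * c * (b * b)
    pointwise a b c d = begin
      2 * (a * b * (c * d))                  ≡⟨ lemma₁ a b c d ⟩
      2 * (a * d * (c * b))                  ≤⟨ 2ab≤a²+b² (a * d) (c * b) ⟩
      a * d * (a * d) + c * b * (c * b)      ≡⟨ lemma₂ a b c d ⟩
      a * a * (d * d) + c * c * (b * b)      ∎
      where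
      lemma₁ : ∀ a b c d → 2 * (a * b * (c * d)) ≡ 2 * (a * d * (c * b))
      lemma₁ = solve-∀
      lemma₂ : ∀ a b c d → a * d * (a * d) + c * b * (c * b) ≡ a * a * (d * d) + c * c * (b * b)
      lemma₂ = solve-∀

  ∃-dyadic : ∀ l v → 0 < v → v < 2 ^ l → ∃ λ j → j < l × 2 ^ j ≤ v × v < 2 ^ suc j
  ∃-dyadic zero    v 0<v v<1 = contradiction 0<v (<⇒≱ v<1)
  ∃-dyadic (suc l) v 0<v v<  with 2 ^ l ≤? v
  ... | yes le = l , ≤-refl , le , v<
  ... | no ¬le = let (j , j< , h) = ∃-dyadic l v 0<v (≰⇒> ¬le) in j , m<n⇒m<1+n j< , h

  -- The one level with 2 ^ j ≤ v < 2 ^ (j + 1) already suffices. All levels are summed so that the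
  -- bound can be exchanged with an outer sum, and the exponent is `suc e` so that v = 0 gives 0.
  dyadic : ∀ l e v → v < 2 ^ l →
           v ^ suc e ≤ ∑[ j ∈ upTo l ] (𝟙 (2 ^ j ≤? v) * (2 ^ suc j) ^ suc e)
  dyadic l e zero    _  = z≤n
  dyadic l e (suc v) v< with ∃-dyadic l (suc v) z<s v<
  ... | j , j< , lo , hi = ≤-trans (^-monoˡ-≤ (suc e) (<⇒≤ hi))
    (≤-trans (≤𝟙* (2 ^ j ≤? suc v) lo) (term≤∑ (λ j → 𝟙 (2 ^ j ≤? suc v) * (2 ^ suc j) ^ suc e) (∈-upTo⁺ j<)))

  -- The elements with k ≡ 0 are those of least key in their colour class, so each of the U colours has at most one.
  length≤colours+pairs : (xs : List X) (key colour : X → ℕ) (U : ℕ) →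
    AllPairs (λ x y → ¬ (key x ≡ key y)) xs → (∀ x → x ∈ xs → colour x < U) →
    length xs ≤ U + ∑[ x ∈ xs ] ∑[ y ∈ xs ] 𝟙 ((colour x ≟ colour y) ×-dec (key x <? key y))
  length≤colours+pairs xs key colour U distinct bound = begin
    length xs
      ≡⟨ length-as-∑ xs ⟩
    ∑[ y ∈ xs ] 1
      ≤⟨ ∑-mono xs (λ y → split (k y)) ⟩
    ∑[ y ∈ xs ] (𝟙 (k y ≟ 0) + k y)
      ≡⟨ ∑-+ xs _ k ⟩
    ∑[ y ∈ xs ] 𝟙 (k y ≟ 0) + ∑ xs k
      ≤⟨ +-mono-≤ minima (≤-reflexive (∑-swap xs xs _)) ⟩
    U + ∑[ x ∈ xs ] ∑[ y ∈ xs ] 𝟙 (below x y) ∎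
    where
    open ≤-Reasoning
    below : ∀ x y → Dec (colour x ≡ colour y × key x < key y)
    below x y = (colour x ≟ colour y) ×-dec (key x <? key y)
    k : _ → ℕ
    k y = ∑[ x ∈ xs ] 𝟙 (below x y)
    split : ∀ m → 1 ≤ 𝟙 (m ≟ 0) + m
    split zero    = ≤-refl
    split (suc m) = ≤-trans (s≤s z≤n) (m≤n+m (suc m) (𝟙 (suc m ≟ 0)))
    minimal : ∀ {x y} → x ∈ xs → k y ≡ 0 → colour x ≡ colour y → ¬ (key x < key y)
    minimal {x} {y} x∈ ky c lt = <⇒≢ (≤-trans (𝟙≥1 (below x y) (c , lt)) (term≤∑ (λ x → 𝟙 (below x y)) x∈)) (sym ky)
    atColour : ∀ y c → Dec (k y ≡ 0 × colour y ≡ c)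
    atColour y c = (k y ≟ 0) ×-dec (colour y ≟ c)
    unique : ∀ c → ∑[ y ∈ xs ] 𝟙 (atColour y c) ≤ 1
    unique c = ∑≤1 distinct (λ y _ → 𝟙≤1 (atColour y c)) λ x y x∈ y∈ hx hy → 
      let (kx , cx) = 𝟙>0⇒ (atColour x c) hx
          (ky , cy) = 𝟙>0⇒ (atColour y c) hy
      in ≤-antisym (≮⇒≥ (minimal y∈ kx (trans cy (sym cx)))) (≮⇒≥ (minimal x∈ ky (trans cx (sym cy))))
    minima : ∑[ y ∈ xs ] 𝟙 (k y ≟ 0) ≤ U
    minima = begin
      ∑[ y ∈ xs ] 𝟙 (k y ≟ 0)
        ≤⟨ ∑-mono-∈ xs (λ y y∈ → 𝟙≤ (k y ≟ 0) λ ky →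
             ≤-trans (𝟙≥1 (atColour y (colour y)) (ky , refl)) (term≤∑ (λ c → 𝟙 (atColour y c)) (∈-upTo⁺ (bound y y∈)))) ⟩
      ∑[ y ∈ xs ] ∑[ c ∈ upTo U ] 𝟙 (atColour y c)
        ≡⟨ ∑-swap xs (upTo U) _ ⟩
      ∑[ c ∈ upTo U ] ∑[ y ∈ xs ] 𝟙 (atColour y c)
        ≤⟨ ∑-≤-const (upTo U) 1 unique ⟩
      length (upTo U) * 1
        ≡⟨ trans (*-identityʳ _) (length-upTo U) ⟩
      U ∎

  empty⊎∃∈ : ∀ {X : Set} (xs : List X) → length xs ≡ 0 ⊎ ∃ (_∈ xs)
  empty⊎∃∈ []       = inj₁ refl
  empty⊎∃∈ (x ∷ xs) = inj₂ (x , here refl)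

  ∑-swap₃ : ∀ {W X Y Z : Set} (xs : List X) (ys : List Y) (zs : List Z) (ws : List W) (f : X → Y → Z → W → ℕ) →
    ∑[ x ∈ xs ] ∑[ y ∈ ys ] ∑[ z ∈ zs ] ∑[ w ∈ ws ] f x y z w ≡ ∑[ w ∈ ws ] ∑[ x ∈ xs ] ∑[ y ∈ ys ] ∑[ z ∈ zs ] f x y z w
  ∑-swap₃ xs ys zs ws f =
    trans (∑-cong xs (λ x → trans (∑-cong ys (λ y → ∑-swap zs ws _)) (∑-swap ys ws _))) (∑-swap xs ws _)

  -- The second moment of the fibre sizes counts pairs with a common image. As `p` has at most one
  -- image in `ts`, each colliding pair is counted at most once.
  ∑-collisions : ∀ {X Y : Set} (ps : List X) (ts : List Y) {M : X → Y → Set} {C : X → X → Set}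
    (M? : ∀ p t → Dec (M p t)) (C? : ∀ p q → Dec (C p q)) →
    (∀ p → ∑[ t ∈ ts ] 𝟙 (M? p t) ≤ 1) → (∀ {p q t} → M p t → M q t → C p q) →
    ∑[ t ∈ ts ] (∑[ p ∈ ps ] 𝟙 (M? p t) * ∑[ p ∈ ps ] 𝟙 (M? p t)) ≤ ∑[ p ∈ ps ] ∑[ q ∈ ps ] 𝟙 (C? p q)
  ∑-collisions ps ts M? C? functional collide = begin
    ∑[ t ∈ ts ] (∑[ p ∈ ps ] 𝟙 (M? p t) * ∑[ p ∈ ps ] 𝟙 (M? p t))
      ≡⟨ ∑-cong ts (λ t → ∑*∑ ps ps _ _) ⟩
    ∑[ t ∈ ts ] ∑[ p ∈ ps ] ∑[ q ∈ ps ] (𝟙 (M? p t) * 𝟙 (M? q t))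
      ≡⟨ trans (∑-swap ts ps _) (∑-cong ps (λ p → ∑-swap ts ps _)) ⟩
    ∑[ p ∈ ps ] ∑[ q ∈ ps ] ∑[ t ∈ ts ] (𝟙 (M? p t) * 𝟙 (M? q t))
      ≤⟨ ∑-mono ps (λ p → ∑-mono ps (λ q → inner p q)) ⟩
    ∑[ p ∈ ps ] ∑[ q ∈ ps ] 𝟙 (C? p q) ∎
    where
    open ≤-Reasoning
    inner : ∀ p q → ∑[ t ∈ ts ] (𝟙 (M? p t) * 𝟙 (M? q t)) ≤ 𝟙 (C? p q)
    inner p q = begin
      ∑[ t ∈ ts ] (𝟙 (M? p t) * 𝟙 (M? q t))
        ≤⟨ ∑-mono ts (λ t → 𝟙*≤ (M? p t) λ mp → 𝟙≤ (M? q t) λ mq →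
             ≤-trans (𝟙≥1 (M? p t) mp) (≤𝟙* (C? p q) (collide mp mq))) ⟩
      ∑[ t ∈ ts ] (𝟙 (C? p q) * 𝟙 (M? p t))
        ≡⟨ ∑-*ˡ ts (𝟙 (C? p q)) _ ⟩
      𝟙 (C? p q) * ∑[ t ∈ ts ] 𝟙 (M? p t)
        ≤⟨ *-monoʳ-≤ (𝟙 (C? p q)) (functional p) ⟩
      𝟙 (C? p q) * 1
        ≡⟨ *-identityʳ _ ⟩
      𝟙 (C? p q) ∎

  ∑-filter-≤ : ∀ {X : Set} {P : X → Set} (P? : ∀ x → Dec (P x)) (xs : List X) (f : X → ℕ) →
               ∑ (filter P? xs) f ≤ ∑ xs f
  ∑-filter-≤ P? xs f = ≤-trans (≤-reflexive (∑-filter P? xs f)) (∑-mono xs (λ x → 𝟙*≤ (P? x) (λ _ → ≤-refl)))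

open FiniteSums

-- Exponential against polynomial growth.

n<2^n : ∀ n → n < 2 ^ n
n<2^n zero    = z<s
n<2^n (suc n) = begin-strict
  suc n          ≤⟨ n<2^n n ⟩
  2 ^ n          <⟨ m<m+n (2 ^ n) (m^n>0 2 n) ⟩
  2 ^ n + 2 ^ n  ≡⟨ cong (2 ^ n +_) (sym (+-identityʳ _)) ⟩
  2 ^ suc n      ∎
  where open ≤-Reasoning

^-distribʳ-* : ∀ e x y → (x * y) ^ e ≡ x ^ e * y ^ e
^-distribʳ-* zero    x y = refl
^-distribʳ-* (suc e) x y = trans (cong (x * y *_) (^-distribʳ-* e x y)) (interchange x y (x ^ e) (y ^ e))
  where
  interchange : ∀ a b c d → a * b * (c * d) ≡ a * c * (b * d)
  interchange = solve-∀

-- Induction on the degree with j = l / 2: since l + 1 ≤ 2 (j + 1), one factor j + 1 is at most 2 ^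
-- j, and the remaining polynomial, with constant `C * 2 ^ suc e`, is at most 2 ^ j by induction.
polynomial≤2^ : ∀ e C → ∃ λ l₀ → ∀ l → l₀ ≤ l → C * suc l ^ e ≤ 2 ^ l
polynomial≤2^ zero C = C , λ l C≤l → ≤-trans (≤-reflexive (*-identityʳ C)) (≤-trans C≤l (<⇒≤ (n<2^n l)))
polynomial≤2^ (suc e) C with polynomial≤2^ e (C * 2 ^ suc e)
... | l₀ , h = l₀ * 2 , λ l 2l₀≤l → bound l (≤-trans (≤-reflexive (sym (m*n/n≡m l₀ 2))) (/-monoˡ-≤ 2 2l₀≤l))
  where
  open ≤-Reasoning
  bound : ∀ l → l₀ ≤ l / 2 → C * suc l ^ suc e ≤ 2 ^ l
  bound l l₀≤j = begin
    C * suc l ^ suc e                          ≤⟨ *-monoʳ-≤ C (^-monoˡ-≤ (suc e) l<) ⟩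
    C * (2 * suc j) ^ suc e                    ≡⟨ cong (C *_) (^-distribʳ-* (suc e) 2 (suc j)) ⟩
    C * (2 ^ suc e * (suc j * suc j ^ e))      ≡⟨ regroup C (2 ^ suc e) (suc j) (suc j ^ e) ⟩
    C * 2 ^ suc e * suc j ^ e * suc j          ≤⟨ *-mono-≤ (h j l₀≤j) (n<2^n j) ⟩
    2 ^ j * 2 ^ j                              ≡⟨ ^-distribˡ-+-* 2 j j ⟨
    2 ^ (j + j)                                ≤⟨ ^-monoʳ-≤ 2 2j≤l ⟩
    2 ^ l                                      ∎
    where
    j : ℕ
    j = l / 2
    regroup : ∀ a b c d → a * (b * (c * d)) ≡ a * b * d * c
    regroup = solve-∀
    l< : suc l ≤ 2 * suc j
    l< = begin
      suc l                  ≡⟨ cong suc (m≡m%n+[m/n]*n l 2) ⟩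
      suc (l % 2) + j * 2    ≤⟨ +-monoˡ-≤ (j * 2) (m%n<n l 2) ⟩
      suc j * 2              ≡⟨ *-comm (suc j) 2 ⟩
      2 * suc j              ∎
    2j≤l : j + j ≤ l
    2j≤l = ≤-trans (≤-reflexive (trans (cong (j +_) (sym (+-identityʳ j))) (*-comm 2 j))) (m/n*n≤m l 2)

-- Elimination of the auxiliary quantities.

module _ (K n l s τ w Q M E u v m D : ℕ) .{{_ : NonZero n}} .{{_ : NonZero w}}
  (energy     : n ^ 4 ≤ K * (l * s * (τ * w)))
  (popular    : τ * τ * w ≤ E)
  (cubic      : E ≤ K * (l * (n * n * n)))
  (collisions : n * n * (w * w) ≤ K * (Q * E))
  (popularity : n * n * Q ≤ K * (s * M))
  (level      : M ≤ K * (l * l * (u * v * m)))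
  (levelᵘ     : m * (u * u * u) ≤ K * (n * (s * s)))
  (levelᵛ₁    : m * v ≤ n * D)
  (levelᵛ₃    : m * (v * v * v) ≤ K * (n * (D * D)))
  (differences : D * τ ≤ w) where
  open ≤-Reasoning

  private
    G : ℕ
    G = u * v * m

  -- Multiplying `collisions` by n² brings out n² Q, to which `popularity` and `level` apply; the n³
  -- of `cubic` then cancels.
  w²≤ : n * (w * w) ≤ K ^ 4 * (l * l * l * (s * G))
  w²≤ = *-cancelʳ-≤ (n * (w * w)) _ (n * n * n) {{m*n≢0 (n * n) n {{m*n≢0 n n}}}} (begin
    n * (w * w) * (n * n * n)                                        ≡⟨ r₁ n w ⟩
    n * n * (w * w) * (n * n)                                        ≤⟨ *-monoˡ-≤ (n * n) collisions ⟩
    K * (Q * E) * (n * n)                                            ≡⟨ r₂ K Q E n ⟩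
    K * E * (n * n * Q)                                              ≤⟨ *-mono-≤ (*-monoʳ-≤ K cubic) popularity ⟩
    K * (K * (l * (n * n * n))) * (K * (s * M))                      ≤⟨ *-monoʳ-≤ (K * (K * (l * (n * n * n)))) (*-monoʳ-≤ K (*-monoʳ-≤ s level)) ⟩
    K * (K * (l * (n * n * n))) * (K * (s * (K * (l * l * G))))      ≡⟨ r₃ K l n s G ⟩
    K ^ 4 * (l * l * l * (s * G)) * (n * n * n)                      ∎)
    where
    r₁ : ∀ n w → n * (w * w) * (n * n * n) ≡ n * n * (w * w) * (n * n)
    r₁ = solve-∀
    r₂ : ∀ K Q E n → K * (Q * E) * (n * n) ≡ K * E * (n * n * Q)
    r₂ = solve-∀
    r₃ : ∀ K l n s G → K * (K * (l * (n * n * n))) * (K * (s * (K * (l * l * G)))) ≡ K ^ 4 * (l * l * l * (s * G)) * (n * n * n)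
    r₃ = +-*-Solver.solve 5 (λ K l n s G → K :* (K :* (l :* (n :* n :* n))) :* (K :* (s :* (K :* (l :* l :* G)))) := K :^ 4 :* (l :* l :* l :* (s :* G)) :* (n :* n :* n)) refl

  -- The exponents 2, 3, 1 in (m u³)² (m v)³ (m v³) make each of u, v, m occur six times.
  G⁶≤ : G ^ 6 ≤ K ^ 3 * (n ^ 6 * (s ^ 4 * D ^ 5))
  G⁶≤ = begin
    G ^ 6
      ≡⟨ r₁ u v m ⟩
    (m * (u * u * u)) ^ 2 * ((m * v) ^ 3 * (m * (v * v * v)))
      ≤⟨ *-mono-≤ (^-monoˡ-≤ 2 levelᵘ) (*-mono-≤ (^-monoˡ-≤ 3 levelᵛ₁) levelᵛ₃) ⟩
    (K * (n * (s * s))) ^ 2 * ((n * D) ^ 3 * (K * (n * (D * D))))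
      ≡⟨ r₂ K n s D ⟩
    K ^ 3 * (n ^ 6 * (s ^ 4 * D ^ 5)) ∎
    where
    r₁ : ∀ u v m → (u * v * m) ^ 6 ≡ (m * (u * u * u)) ^ 2 * ((m * v) ^ 3 * (m * (v * v * v)))
    r₁ = +-*-Solver.solve 3 (λ u v m → (u :* v :* m) :^ 6 := (m :* (u :* u :* u)) :^ 2 :* ((m :* v) :^ 3 :* (m :* (v :* v :* v)))) refl
    r₂ : ∀ K n s D → (K * (n * (s * s))) ^ 2 * ((n * D) ^ 3 * (K * (n * (D * D)))) ≡ K ^ 3 * (n ^ 6 * (s ^ 4 * D ^ 5))
    r₂ = +-*-Solver.solve 4 (λ K n s D → (K :* (n :* (s :* s))) :^ 2 :* ((n :* D) :^ 3 :* (K :* (n :* (D :* D)))) := K :^ 3 :* (n :^ 6 :* (s :^ 4 :* D :^ 5))) refl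

  -- In the sixth power of `w²≤` the factor D⁵ coming from `G⁶≤` is paired with τ⁵, and (D τ)⁵ ≤ w⁵
  -- reduces w¹² to w⁷.
  w⁷τ⁵≤ : w ^ 7 * τ ^ 5 ≤ K ^ 27 * (l ^ 18 * s ^ 10)
  w⁷τ⁵≤ = *-cancelʳ-≤ _ _ (n ^ 6 * w ^ 5) {{m*n≢0 (n ^ 6) (w ^ 5) {{m^n≢0 n 6}} {{m^n≢0 w 5}}}} (begin
    w ^ 7 * τ ^ 5 * (n ^ 6 * w ^ 5)
      ≡⟨ r₁ w τ n ⟩
    (n * (w * w)) ^ 6 * τ ^ 5
      ≤⟨ *-monoˡ-≤ (τ ^ 5) (^-monoˡ-≤ 6 w²≤) ⟩
    (K ^ 4 * (l * l * l * (s * G))) ^ 6 * τ ^ 5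
      ≡⟨ r₂ K l s G τ ⟩
    K ^ 24 * (l ^ 18 * s ^ 6) * τ ^ 5 * G ^ 6
      ≤⟨ *-monoʳ-≤ (K ^ 24 * (l ^ 18 * s ^ 6) * τ ^ 5) G⁶≤ ⟩
    K ^ 24 * (l ^ 18 * s ^ 6) * τ ^ 5 * (K ^ 3 * (n ^ 6 * (s ^ 4 * D ^ 5)))
      ≡⟨ r₃ K l s τ n D ⟩
    K ^ 27 * (l ^ 18 * s ^ 10) * (n ^ 6 * (D * τ) ^ 5)
      ≤⟨ *-monoʳ-≤ (K ^ 27 * (l ^ 18 * s ^ 10)) (*-monoʳ-≤ (n ^ 6) (^-monoˡ-≤ 5 differences)) ⟩
    K ^ 27 * (l ^ 18 * s ^ 10) * (n ^ 6 * w ^ 5) ∎)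
    where
    r₁ : ∀ w τ n → w ^ 7 * τ ^ 5 * (n ^ 6 * w ^ 5) ≡ (n * (w * w)) ^ 6 * τ ^ 5
    r₁ = +-*-Solver.solve 3 (λ w τ n → w :^ 7 :* τ :^ 5 :* (n :^ 6 :* w :^ 5) := (n :* (w :* w)) :^ 6 :* τ :^ 5) refl
    r₂ : ∀ K l s G τ → (K ^ 4 * (l * l * l * (s * G))) ^ 6 * τ ^ 5 ≡ K ^ 24 * (l ^ 18 * s ^ 6) * τ ^ 5 * G ^ 6
    r₂ = +-*-Solver.solve 5 (λ K l s G τ → (K :^ 4 :* (l :* l :* l :* (s :* G))) :^ 6 :* τ :^ 5 := K :^ 24 :* (l :^ 18 :* s :^ 6) :* τ :^ 5 :* G :^ 6) refl
    r₃ : ∀ K l s τ n D → K ^ 24 * (l ^ 18 * s ^ 6) * τ ^ 5 * (K ^ 3 * (n ^ 6 * (s ^ 4 * D ^ 5))) ≡ K ^ 27 * (l ^ 18 * s ^ 10) * (n ^ 6 * (D * τ) ^ 5)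
    r₃ = +-*-Solver.solve 6 (λ K l s τ n D → K :^ 24 :* (l :^ 18 :* s :^ 6) :* τ :^ 5 :* (K :^ 3 :* (n :^ 6 :* (s :^ 4 :* D :^ 5))) := K :^ 27 :* (l :^ 18 :* s :^ 10) :* (n :^ 6 :* (D :* τ) :^ 5)) refl

  -- The ninth power of `energy` contains τ⁹ w⁹ = (w⁷ τ⁵) (τ² w)², and both factors are bounded
  -- without τ and w.
  n³⁰≤ : n ^ 30 ≤ K ^ 38 * l ^ 29 * s ^ 19
  n³⁰≤ = *-cancelʳ-≤ _ _ (n ^ 6) {{m^n≢0 n 6}} (begin
    n ^ 30 * n ^ 6
      ≡⟨ r₁ n ⟩
    (n ^ 4) ^ 9
      ≤⟨ ^-monoˡ-≤ 9 energy ⟩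
    (K * (l * s * (τ * w))) ^ 9
      ≡⟨ r₂ K l s τ w ⟩
    K ^ 9 * (l ^ 9 * s ^ 9) * (w ^ 7 * τ ^ 5 * (τ * τ * w) ^ 2)
      ≤⟨ *-monoʳ-≤ (K ^ 9 * (l ^ 9 * s ^ 9)) (*-mono-≤ w⁷τ⁵≤ (^-monoˡ-≤ 2 (≤-trans popular cubic))) ⟩
    K ^ 9 * (l ^ 9 * s ^ 9) * (K ^ 27 * (l ^ 18 * s ^ 10) * (K * (l * (n * n * n))) ^ 2)
      ≡⟨ r₃ K l s n ⟩
    K ^ 38 * l ^ 29 * s ^ 19 * n ^ 6 ∎)
    where
    r₁ : ∀ n → n ^ 30 * n ^ 6 ≡ (n ^ 4) ^ 9
    r₁ = +-*-Solver.solve 1 (λ n → n :^ 30 :* n :^ 6 := (n :^ 4) :^ 9) refl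
    r₂ : ∀ K l s τ w → (K * (l * s * (τ * w))) ^ 9 ≡ K ^ 9 * (l ^ 9 * s ^ 9) * (w ^ 7 * τ ^ 5 * (τ * τ * w) ^ 2)
    r₂ = +-*-Solver.solve 5 (λ K l s τ w → (K :* (l :* s :* (τ :* w))) :^ 9 := K :^ 9 :* (l :^ 9 :* s :^ 9) :* (w :^ 7 :* τ :^ 5 :* (τ :* τ :* w) :^ 2)) refl
    r₃ : ∀ K l s n → K ^ 9 * (l ^ 9 * s ^ 9) * (K ^ 27 * (l ^ 18 * s ^ 10) * (K * (l * (n * n * n))) ^ 2) ≡ K ^ 38 * l ^ 29 * s ^ 19 * n ^ 6
    r₃ = +-*-Solver.solve 4 (λ K l s n → K :^ 9 :* (l :^ 9 :* s :^ 9) :* (K :^ 27 :* (l :^ 18 :* s :^ 10) :* (K :* (l :* (n :* n :* n))) :^ 2) := K :^ 38 :* l :^ 29 :* s :^ 19 :* n :^ 6) refl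

-- A bound for every l with n < 2 ^ l is a bound with l ≈ log₂ n, and powers of log₂ n are o(n).
absorb-logarithm : ∀ C k → ∃ λ N → 0 < N × (∀ n s → N ≤ n →
  (∀ l → 0 < l → n < 2 ^ l → n ^ 30 ≤ C * l ^ 29 * s ^ 19) → n ^ (30 * suc k ∸ 19) ≤ s ^ (19 * suc k))
absorb-logarithm C k = 2 ^ l₀ , m^n>0 2 l₀ , bound
  where
  open ≤-Reasoning
  l₀ : ℕ
  l₀ = proj₁ (polynomial≤2^ (29 * suc k) (C ^ suc k))

  bound : ∀ n s → 2 ^ l₀ ≤ n → (∀ l → 0 < l → n < 2 ^ l → n ^ 30 ≤ C * l ^ 29 * s ^ 19) →
          n ^ (30 * suc k ∸ 19) ≤ s ^ (19 * suc k)
  -- The 19 subtracted in the exponent leaves a factor n¹⁹ to absorb the constant and the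
  -- logarithms.
  bound n s N≤n h = *-cancelˡ-≤ (n ^ 19) {{m^n≢0 n 19}} (begin
    n ^ 19 * n ^ (30 * suc k ∸ 19)                  ≡⟨ sym (^-distribˡ-+-* n 19 (30 * suc k ∸ 19)) ⟩
    n ^ (19 + (30 * suc k ∸ 19))                    ≡⟨ cong (n ^_) (m+[n∸m]≡n 19≤30*) ⟩
    n ^ (30 * suc k)                                ≡⟨ sym (^-*-assoc n 30 (suc k)) ⟩
    (n ^ 30) ^ suc k                                ≤⟨ ^-monoˡ-≤ (suc k) (h (suc l) z<s n<2^1+l) ⟩
    (C * suc l ^ 29 * s ^ 19) ^ suc k               ≡⟨ ^-distribʳ-* (suc k) (C * suc l ^ 29) (s ^ 19) ⟩
    (C * suc l ^ 29) ^ suc k * (s ^ 19) ^ suc k     ≤⟨ *-monoˡ-≤ ((s ^ 19) ^ suc k) small ⟩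
    n ^ 19 * (s ^ 19) ^ suc k                       ≡⟨ cong (n ^ 19 *_) (^-*-assoc s 19 (suc k)) ⟩
    n ^ 19 * s ^ (19 * suc k)                       ∎)
    where
    instance
      n≢0 : NonZero n
      n≢0 = >-nonZero (≤-trans (m^n>0 2 l₀) N≤n)
    scale : ∃ λ l → l < n × 2 ^ l ≤ n × n < 2 ^ suc l
    scale = ∃-dyadic n n (≤-trans (m^n>0 2 l₀) N≤n) (n<2^n n)
    l : ℕ
    l = proj₁ scale
    2^l≤n : 2 ^ l ≤ n
    2^l≤n = proj₁ (proj₂ (proj₂ scale))
    n<2^1+l : n < 2 ^ suc l
    n<2^1+l = proj₂ (proj₂ (proj₂ scale))
    19≤30* : 19 ≤ 30 * suc k
    19≤30* = ≤-trans (m≤m+n 19 11) (m≤m*n 30 (suc k))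
    l₀≤l : l₀ ≤ l
    l₀≤l = ≮⇒≥ λ l<l₀ → <⇒≱ n<2^1+l (≤-trans (^-monoʳ-≤ 2 l<l₀) N≤n)
    small : (C * suc l ^ 29) ^ suc k ≤ n ^ 19
    small = begin
      (C * suc l ^ 29) ^ suc k                ≡⟨ ^-distribʳ-* (suc k) C (suc l ^ 29) ⟩
      C ^ suc k * (suc l ^ 29) ^ suc k        ≡⟨ cong (C ^ suc k *_) (^-*-assoc (suc l) 29 (suc k)) ⟩
      C ^ suc k * suc l ^ (29 * suc k)        ≤⟨ proj₂ (polynomial≤2^ (29 * suc k) (C ^ suc k)) l l₀≤l ⟩
      2 ^ l                                   ≤⟨ 2^l≤n ⟩
      n                                       ≤⟨ m≤m*n n (n ^ 18) {{m^n≢0 n 18}} ⟩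
      n ^ 19                                  ∎

-- This is what allows a sum of two block numbers to serve as a colour: between points ordered in
-- both coordinates, equal sums force equal blocks.
+-≡-≤⇒≡ : ∀ {p q p′ q′} → p ≤ p′ → q ≤ q′ → p + q ≡ p′ + q′ → p ≡ p′ × q ≡ q′
+-≡-≤⇒≡ {p} {q} {p′} {q′} pp qq e =
  ≤-antisym pp (+-cancelʳ-≤ q p′ p (≤-trans (+-monoʳ-≤ p′ qq) (≤-reflexive (sym e)))) ,
  ≤-antisym qq (+-cancelˡ-≤ p q′ q (≤-trans (+-monoˡ-≤ q′ pp) (≤-reflexive (sym e))))

/-same⇒< : ∀ i i′ h .{{_ : NonZero h}} → i / h ≡ i′ / h → i′ < i + h
/-same⇒< i i′ h e = begin-strict
  i′                    ≡⟨ m≡m%n+[m/n]*n i′ h ⟩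
  i′ % h + i′ / h * h   <⟨ +-monoˡ-< (i′ / h * h) (m%n<n i′ h) ⟩
  h + i′ / h * h        ≡⟨ cong (λ q → h + q * h) (sym e) ⟩
  h + i / h * h         ≤⟨ +-monoʳ-≤ h (m/n*n≤m i h) ⟩
  h + i                 ≡⟨ +-comm h i ⟩
  i + h                 ∎
  where open ≤-Reasoning

-- Order and decidability in the real field.

module OrderedGroup (R : RealField 0ℓ 0ℓ) where
  open RealField R
    renaming (_+_ to _⊞_; _-_ to _⊟_; -_ to ⊟_; _<_ to _≺_; _≤_ to _≼_; +-mono-< to ⊞-mono-≺)

  commutativeRing : CommutativeRing 0ℓ 0ℓ
  commutativeRing = record { isCommutativeRing = isCommutativeRing }

  open CommutativeRing commutativeRing public
    using (-‿inverseˡ; -‿inverseʳ; -‿cong; +-commutativeMonoid; +-group; ring)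
    renaming (refl to ≈-refl; sym to ≈-sym; trans to ≈-trans; +-cong to ⊞-cong; +-comm to ⊞-comm;
              +-assoc to ⊞-assoc; +-identityʳ to ⊞-identityʳ; +-identityˡ to ⊞-identityˡ)
  open IsStrictPartialOrder isStrictPartialOrder public using ()
    renaming (irrefl to ≺-irrefl; trans to ≺-trans; asym to ≺-asym; <-respʳ-≈ to ≺-respʳ-≈; <-respˡ-≈ to ≺-respˡ-≈)
  open import Algebra.Properties.Group +-group public using ()
    renaming (∙-cancelʳ to ⊞-cancelʳ; ⁻¹-involutive to -‿involutive; ⁻¹-injective to -‿injective)
  open import Algebra.Properties.Ring ring using (-1*x≈-x)
  open import Algebra.Solver.CommutativeMonoid +-commutativeMonoid public
    using (solve; _⊜_; _⊕_)

  x⊟y⊞y≈x : ∀ x y → x ⊟ y ⊞ y ≈ x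
  x⊟y⊞y≈x x y = ≈-trans (⊞-assoc x (⊟ y) y) (≈-trans (⊞-cong ≈-refl (-‿inverseˡ y)) (⊞-identityʳ x))

  ⊞-cancel-≺ : ∀ {x y} z → x ⊞ z ≺ y ⊞ z → x ≺ y
  ⊞-cancel-≺ {x} {y} z h = ≺-respʳ-≈ (cancel y) (≺-respˡ-≈ (cancel x) (⊞-mono-≺ (⊟ z) h))
    where
    cancel : ∀ w → w ⊞ z ⊞ ⊟ z ≈ w
    cancel w = ≈-trans (⊞-assoc w z (⊟ z)) (≈-trans (⊞-cong ≈-refl (-‿inverseʳ z)) (⊞-identityʳ w))

  ⊞-mono₂-≺ : ∀ {x y x′ y′} → x ≺ y → x′ ≺ y′ → x ⊞ x′ ≺ y ⊞ y′
  ⊞-mono₂-≺ {x} {y} {x′} {y′} h h′ =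
    ≺-trans (⊞-mono-≺ x′ h) (≺-respʳ-≈ (⊞-comm y′ y) (≺-respˡ-≈ (⊞-comm x′ y) (⊞-mono-≺ y h′)))

  0≺1 : 0# ≺ 1#
  0≺1 with connected 0# 1# 0≉1
  ... | inj₁ h = h
  ... | inj₂ h = ≺-respʳ-≈ (≈-trans (-1*x≈-x (⊟ 1#)) (-‿involutive 1#)) (*-pos 0≺-1 0≺-1)
    where
    0≺-1 : 0# ≺ ⊟ 1#
    0≺-1 = ≺-respʳ-≈ (⊞-identityˡ (⊟ 1#)) (≺-respˡ-≈ (-‿inverseʳ 1#) (⊞-mono-≺ (⊟ 1#) h))

  -- Completeness is stated with a decided order, so a supremum of {0} ∪ {1 : Q} decides the negation of Q.
  weakLEM : (Q : Set) → ¬ Q ⊎ ¬ ¬ Q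
  weakLEM Q with completeness (λ z → (z ≈ 0#) ⊎ (z ≈ 1# × Q)) (0# , inj₁ ≈-refl)
                   (1# , λ { z (inj₁ z≈0) → inj₁ (≺-respˡ-≈ (≈-sym z≈0) 0≺1) ; z (inj₂ (z≈1 , _)) → inj₂ z≈1 })
  ... | s , upper , least with upper 0# (inj₁ ≈-refl)
  ...   | inj₁ 0<s = inj₂ λ ¬q → <⇒¬≤ 0<s (least 0# λ { z (inj₁ z≈0) → inj₂ z≈0 ; z (inj₂ (_ , q)) → contradiction q ¬q })
    where
    <⇒¬≤ : ∀ {x y} → x ≺ y → ¬ (y ≼ x)
    <⇒¬≤ x<y (inj₁ y<x) = ≺-asym x<y y<x
    <⇒¬≤ x<y (inj₂ y≈x) = ≺-irrefl (≈-sym y≈x) x<y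
  ...   | inj₂ 0≈s = inj₁ λ q → 1≰s (upper 1# (inj₂ (≈-refl , q)))
    where
    1≰s : ¬ (1# ≼ s)
    1≰s (inj₁ 1<s) = ≺-asym 0≺1 (≺-respʳ-≈ (≈-sym 0≈s) 1<s)
    1≰s (inj₂ 1≈s) = 0≉1 (≈-trans 0≈s (≈-sym 1≈s))

  -- The supremum s of {0 , x} comes with decided comparisons 0 ≤ s and x ≤ s. The double negation
  -- suffices to refute both strict cases, and what remains, 0 ≈ s ≈ x, is the equality itself.
  ≈0-stable : ∀ x → ¬ ¬ (x ≈ 0#) → x ≈ 0#
  ≈0-stable x ¬¬x≈0 with completeness (λ z → (z ≈ 0#) ⊎ (z ≈ x)) (0# , inj₁ ≈-refl) (1# , bound)
    where
    x<1 : x ≺ 1#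
    x<1 with connected x 1# (λ x≈1 → ¬¬x≈0 (λ x≈0 → 0≉1 (≈-trans (≈-sym x≈0) x≈1)))
    ... | inj₁ h = h
    ... | inj₂ h = ⊥-elim (¬¬x≈0 (λ x≈0 → ≺-asym 0≺1 (≺-respʳ-≈ x≈0 h)))
    bound : ∀ z → (z ≈ 0#) ⊎ (z ≈ x) → z ≼ 1#
    bound z (inj₁ z≈0) = inj₁ (≺-respˡ-≈ (≈-sym z≈0) 0≺1)
    bound z (inj₂ z≈x) = inj₁ (≺-respˡ-≈ (≈-sym z≈x) x<1)
  ... | s , upper , least = decide (upper 0# (inj₁ ≈-refl)) (upper x (inj₂ ≈-refl))
    where
    s≤0 : x ≈ 0# → s ≼ 0#
    s≤0 x≈0 = least 0# λ { z (inj₁ z≈0) → inj₂ z≈0 ; z (inj₂ z≈x) → inj₂ (≈-trans z≈x x≈0) }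
    0≮s : ¬ (0# ≺ s)
    0≮s 0<s = ¬¬x≈0 (λ x≈0 → case (s≤0 x≈0))
      where
      case : ¬ (s ≼ 0#)
      case (inj₁ s<0) = ≺-asym 0<s s<0
      case (inj₂ s≈0) = ≺-irrefl (≈-sym s≈0) 0<s
    decide : 0# ≼ s → x ≼ s → x ≈ 0#
    decide (inj₁ 0<s) _          = ⊥-elim (0≮s 0<s)
    decide (inj₂ 0≈s) (inj₁ x<s) = ⊥-elim (¬¬x≈0 (λ x≈0 → ≺-irrefl (≈-trans x≈0 0≈s) x<s))
    decide (inj₂ 0≈s) (inj₂ x≈s) = ≈-trans x≈s (≈-sym 0≈s)

  infix 4 _≈?_ _≺?_

  _≈?_ : ∀ x y → Dec (x ≈ y)
  x ≈? y with weakLEM (x ⊟ y ≈ 0#)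
  ... | inj₁ ≉0 = no λ x≈y → ≉0 (≈-trans (⊞-cong x≈y ≈-refl) (-‿inverseʳ y))
  ... | inj₂ ¬¬≈0 = yes (≈-trans (≈-sym (x⊟y⊞y≈x x y)) (≈-trans (⊞-cong (≈0-stable (x ⊟ y) ¬¬≈0) ≈-refl) (⊞-identityˡ y)))

  _≺?_ : ∀ x y → Dec (x ≺ y)
  x ≺? y with x ≈? y
  ... | yes x≈y = no (≺-irrefl x≈y)
  ... | no x≉y with connected x y x≉y
  ...   | inj₁ x<y = yes x<y
  ...   | inj₂ y<x = no (≺-asym y<x)

  ⊀∧⊁⇒≈ : ∀ {x y} → ¬ (x ≺ y) → ¬ (y ≺ x) → x ≈ y
  ⊀∧⊁⇒≈ {x} {y} x≮y y≮x with x ≈? y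
  ... | yes x≈y = x≈y
  ... | no x≉y with connected x y x≉y
  ...   | inj₁ x<y = contradiction x<y x≮y
  ...   | inj₂ y<x = contradiction y<x y≮x

  -- x ≈ y as a consequence of given equations: the last hypothesis is an identity of commutative monoids.
  linear₁ : ∀ {x y p q} → p ≈ q → x ⊞ q ≈ y ⊞ p → x ≈ y
  linear₁ {x} {y} {p} {q} p≈q h = ⊞-cancelʳ q x y (≈-trans h (⊞-cong ≈-refl p≈q))

  linear₂ : ∀ {x y p q p′ q′} → p ≈ q → p′ ≈ q′ → x ⊞ (q ⊞ q′) ≈ y ⊞ (p ⊞ p′) → x ≈ y
  linear₂ e e′ = linear₁ (⊞-cong e e′)

  linear₃ : ∀ {x y p q p′ q′ p″ q″} → p ≈ q → p′ ≈ q′ → p″ ≈ q″ →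
            x ⊞ (q ⊞ (q′ ⊞ q″)) ≈ y ⊞ (p ⊞ (p′ ⊞ p″)) → x ≈ y
  linear₃ e e′ e″ = linear₂ e (⊞-cong e′ e″)

  -- The telescoping step: two inequalities are added and the common summand `w` is cancelled.
  ≺-sum : ∀ {u v w x y x′ y′} → x ≺ y → x′ ≺ y′ → x ⊞ x′ ≈ u ⊞ w → y ⊞ y′ ≈ v ⊞ w → u ≺ v
  ≺-sum {w = w} h h′ e e′ = ⊞-cancel-≺ w (≺-respʳ-≈ e′ (≺-respˡ-≈ e (⊞-mono₂-≺ h h′)))

  -- Gaps of a convex sequence.

  module _ {n : ℕ} {a : Fin n → Carrier} (convex : Convex R n a) where

    a-mono : ∀ {i j} → toℕ i < toℕ j → a i ≺ a j
    a-mono {i} {j} = proj₁ convex i j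

    a-injective : ∀ {i j} → a i ≈ a j → i ≡ j
    a-injective {i} {j} e with <-cmp (toℕ i) (toℕ j)
    ... | tri< lt _ _ = contradiction (a-mono lt) (≺-irrefl e)
    ... | tri≈ _ eq _ = toℕ-injective eq
    ... | tri> _ _ gt = contradiction (a-mono gt) (≺-irrefl (≈-sym e))

    -- The inequality of differences with the subtractions moved across, so that later
    -- rearrangements are identities of commutative monoids.
    convexity : ∀ {i j k} → toℕ j ≡ suc (toℕ i) → toℕ k ≡ suc (toℕ j) → a j ⊞ a j ≺ a k ⊞ a i
    convexity {i} {j} {k} ij jk =
      ≺-respʳ-≈ (≈-trans (swap (a k ⊟ a j) (a i) (a j)) (⊞-cong (x⊟y⊞y≈x (a k) (a j)) ≈-refl))
        (≺-respˡ-≈ (⊞-cong (x⊟y⊞y≈x (a j) (a i)) ≈-refl)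
          (⊞-mono-≺ (a j) (⊞-mono-≺ (a i) (proj₂ convex i j k ij jk))))
      where
      swap : ∀ x y z → x ⊞ y ⊞ z ≈ x ⊞ z ⊞ y
      swap = solve 3 (λ x y z → (x ⊕ y) ⊕ z ⊜ (x ⊕ z) ⊕ y) ≈-refl

    -- Consecutive differences increase at any distance: convexity is chained from the step at `i`
    -- to the step at `j`, by induction on the distance.
    step-mono : ∀ k {i i⁺ j j⁺} → toℕ i⁺ ≡ suc (toℕ i) → toℕ j ≡ suc k + toℕ i → toℕ j⁺ ≡ suc (toℕ j) →
                a i⁺ ⊞ a j ≺ a j⁺ ⊞ a i
    step-mono zero {i} {i⁺} {j} ii jk jj with toℕ-injective {i = i⁺} {j} (trans ii (sym jk))
    ... | refl = convexity ii jj
    step-mono (suc k) {i} {i⁺} {j} {j⁺} ii jk jj =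
      ≺-sum (step-mono k ii e (trans jk (cong suc (sym e)))) (convexity (trans jk (cong suc (sym e))) jj)
        (solve 3 (λ i⁺ j⁻ j → (i⁺ ⊕ j⁻) ⊕ (j ⊕ j) ⊜ (i⁺ ⊕ j) ⊕ (j ⊕ j⁻)) ≈-refl (a i⁺) (a j⁻) (a j))
        (solve 4 (λ i j⁺ j⁻ j → (j ⊕ i) ⊕ (j⁺ ⊕ j⁻) ⊜ (j⁺ ⊕ i) ⊕ (j ⊕ j⁻)) ≈-refl (a i) (a j⁺) (a j⁻) (a j))
      where
      j⁻<n : suc k + toℕ i < n
      j⁻<n = <-trans (n<1+n _) (subst (_< n) jk (toℕ<n j))
      j⁻ : Fin n
      j⁻ = fromℕ< j⁻<n
      e : toℕ j⁻ ≡ suc k + toℕ i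
      e = toℕ-fromℕ< j⁻<n

    -- Moving a window of length k + 1 one place to the right drops its first step and gains a
    -- larger one at the end. The induction is on the displacement d + 1.
    gap-mono : ∀ d k {i j i′ j′} → toℕ j ≡ suc d + toℕ i →
               toℕ i′ ≡ suc k + toℕ i → toℕ j′ ≡ suc k + toℕ j → a i′ ⊞ a j ≺ a j′ ⊞ a i
    gap-mono zero k {i} {j} {i′} {j′} ij ii jj =
      ≺-respˡ-≈ (⊞-comm (a j) (a i′)) (step-mono k ij ii
        (trans jj (trans (cong (suc k +_) ij) (trans (+-suc (suc k) (toℕ i)) (cong suc (sym ii))))))
    gap-mono (suc d) k {i} {j} {i′} {j′} ij ii jj =
      ≺-sum (gap-mono d k e ii e′) (step-mono k (trans ij (cong suc (sym e))) e′
              (trans jj (trans (cong (suc k +_) ij) (trans (+-suc (suc k) _) (cong suc (trans (cong (suc k +_) (sym e)) (sym e′)))))))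
        (solve 4 (λ i′ j⁻ j j′⁻ → (i′ ⊕ j⁻) ⊕ (j ⊕ j′⁻) ⊜ (i′ ⊕ j) ⊕ (j⁻ ⊕ j′⁻)) ≈-refl (a i′) (a j⁻) (a j) (a j′⁻))
        (solve 4 (λ i j⁻ j′ j′⁻ → (j′⁻ ⊕ i) ⊕ (j′ ⊕ j⁻) ⊜ (j′ ⊕ i) ⊕ (j⁻ ⊕ j′⁻)) ≈-refl (a i) (a j⁻) (a j′) (a j′⁻))
      where
      j⁻<n : suc d + toℕ i < n
      j⁻<n = <-trans (n<1+n _) (subst (_< n) ij (toℕ<n j))
      j⁻ : Fin n
      j⁻ = fromℕ< j⁻<n
      e : toℕ j⁻ ≡ suc d + toℕ i
      e = toℕ-fromℕ< j⁻<n
      j′⁻<n : suc k + toℕ j⁻ < n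
      j′⁻<n = <-trans (subst (suc k + toℕ j⁻ <_) (sym jj)
        (+-monoʳ-< (suc k) (subst₂ _<_ (sym e) (sym ij) (n<1+n _)))) (toℕ<n j′)
      j′⁻ : Fin n
      j′⁻ = fromℕ< j′⁻<n
      e′ : toℕ j′⁻ ≡ suc k + toℕ j⁻
      e′ = toℕ-fromℕ< j′⁻<n

    -- At a fixed index distance a gap determines its position. In this form convexity enters the
    -- incidence bound.
    gap-injective : ∀ k {i j i′ j′} → toℕ i′ ≡ suc k + toℕ i → toℕ j′ ≡ suc k + toℕ j →
                    a i′ ⊞ a j ≈ a j′ ⊞ a i → i ≡ j
    gap-injective k {i} {j} ii jj e = case <-cmp (toℕ i) (toℕ j) of λ where
        (tri≈ _ eq _) → toℕ-injective eq
        (tri< lt _ _) → contradiction (gap-mono _ k (offset lt) ii jj) (≺-irrefl e)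
        (tri> _ _ gt) → contradiction (gap-mono _ k (offset gt) jj ii) (≺-irrefl (≈-sym e))
      where
      offset : ∀ {m o} → m < o → o ≡ suc (o ∸ suc m) + m
      offset {m} {o} h = trans (sym (m∸n+n≡m h)) (+-suc (o ∸ suc m) m)

-- Abstract, so that products such as C * x do not reduce.
abstract
  C K : ℕ
  C = 1024
  K = 8192

  9≤C : 9 ≤ C
  9≤C = m≤m+n 9 1015

  C≡ : 512 * 2 ≡ C
  C≡ = refl

  K≡8C : 8 * C ≡ K
  K≡8C = refl

  C≤K : C ≤ K
  C≤K = m≤m+n 1024 7168

  32≤K : 32 ≤ K
  32≤K = m≤m+n 32 8160

-- Ranks, representation counts and the incidence bound.

module Sumsets (R : RealField 0ℓ 0ℓ) where
  open RealField R public using (Carrier; _≈_) renaming (_+_ to _⊞_; _-_ to _⊟_; -_ to ⊟_; _<_ to _≺_)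
  open OrderedGroup R public renaming (solve to ⊞-solve)

  Unique : List Carrier → Set
  Unique = AllPairs (λ x y → ¬ (x ≈ y))

  ∑𝟙≤𝟙 : {B : List Carrier} {P : Carrier → Set} {Q : Set} (P? : ∀ b → Dec (P b)) (Q? : Dec Q) → Unique B →
         (∀ b b′ → P b → P b′ → b ≈ b′) → (∀ b → b ∈ B → P b → Q) → ∑[ b ∈ B ] 𝟙 (P? b) ≤ 𝟙 Q?
  ∑𝟙≤𝟙 P? (yes _) uB h _ =
    ∑≤1 uB (λ b _ → 𝟙≤1 (P? b)) (λ b b′ _ _ p p′ → h b b′ (𝟙>0⇒ (P? b) p) (𝟙>0⇒ (P? b′) p′))
  ∑𝟙≤𝟙 {B} P? (no ¬q) uB _ h =
    ≮⇒≥ λ pos → let (b , b∈ , p) = ∑>0⇒∃ B pos in ¬q (h b b∈ (𝟙>0⇒ (P? b) p))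

  module Rank (B : List Carrier) where
    m : ℕ
    m = length B

    -- Counting the elements below `z` numbers `B` increasingly without sorting the list, and also
    -- makes sense outside `B`.
    rank : Carrier → ℕ
    rank z = ∑[ b ∈ B ] 𝟙 (b ≺? z)

    rank≤m : ∀ z → rank z ≤ m
    rank≤m z = ≤-trans (∑-≤-const B 1 (λ b → 𝟙≤1 (b ≺? z))) (≤-reflexive (*-identityʳ m))

    rank-mono : ∀ {z w} → z ≺ w → rank z ≤ rank w
    rank-mono {z} {w} z≺w = ∑-mono B λ b → 𝟙≤ (b ≺? z) λ b≺z → 𝟙≥1 (b ≺? w) (≺-trans b≺z z≺w)

    rank-cong : ∀ {z w} → z ≈ w → rank z ≡ rank w
    rank-cong e = ≤-antisym (half e) (half (≈-sym e))
      where
      half : ∀ {z w} → z ≈ w → rank z ≤ rank w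
      half {z} {w} e = ∑-mono B λ b → 𝟙≤ (b ≺? z) λ b≺z → 𝟙≥1 (b ≺? w) (≺-respʳ-≈ e b≺z)

    rank-strict : ∀ {z w} → z ∈ B → z ≺ w → rank z < rank w
    rank-strict {z} {w} z∈ z≺w = begin
      1 + rank z
        ≤⟨ +-monoˡ-≤ (rank z) (≤-trans (𝟙≥1 (z ≈? z) ≈-refl) (term≤∑ (λ b → 𝟙 (b ≈? z)) z∈)) ⟩
      ∑[ b ∈ B ] 𝟙 (b ≈? z) + rank z
        ≡⟨ ∑-+ B _ _ ⟨
      ∑[ b ∈ B ] (𝟙 (b ≈? z) + 𝟙 (b ≺? z))
        ≤⟨ ∑-mono B pointwise ⟩
      rank w ∎
      where
      open ≤-Reasoning
      pointwise : ∀ b → 𝟙 (b ≈? z) + 𝟙 (b ≺? z) ≤ 𝟙 (b ≺? w)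
      pointwise b with b ≈? z | b ≺? z
      ... | yes b≈z | yes b≺z = contradiction b≺z (≺-irrefl b≈z)
      ... | yes b≈z | no _    = 𝟙≥1 (b ≺? w) (≺-respˡ-≈ (≈-sym b≈z) z≺w)
      ... | no _    | yes b≺z = 𝟙≥1 (b ≺? w) (≺-trans b≺z z≺w)
      ... | no _    | no _    = z≤n

    rank-injective : ∀ {z w} → z ∈ B → w ∈ B → rank z ≡ rank w → z ≈ w
    rank-injective z∈ w∈ e = ⊀∧⊁⇒≈ (λ lt → <⇒≢ (rank-strict z∈ lt) e) (λ gt → <⇒≢ (rank-strict w∈ gt) (sym e))

    -- A block consists of the ranks r + q g with r < g, and each rank is attained at most once on
    -- `B`.
    blockSize : Unique B → ∀ g .{{_ : NonZero g}} q → ∑[ b ∈ B ] 𝟙 (rank b / g ≟ q) ≤ g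
    blockSize uB g q = begin
      ∑[ b ∈ B ] 𝟙 (rank b / g ≟ q)
        ≤⟨ ∑-mono B (λ b → 𝟙≤ (rank b / g ≟ q) λ e →
             ≤-trans (𝟙≥1 (at b (rank b % g)) (trans (m≡m%n+[m/n]*n (rank b) g) (cong (λ q → rank b % g + q * g) e)))
                     (term≤∑ (λ r → 𝟙 (at b r)) (∈-upTo⁺ (m%n<n (rank b) g)))) ⟩
      ∑[ b ∈ B ] ∑[ r ∈ upTo g ] 𝟙 (at b r)
        ≡⟨ ∑-swap B (upTo g) _ ⟩
      ∑[ r ∈ upTo g ] ∑[ b ∈ B ] 𝟙 (at b r)
        ≤⟨ ∑-≤-const (upTo g) 1 (λ r → ∑≤1 uB (λ b _ → 𝟙≤1 (at b r)) λ b b′ b∈ b′∈ p p′ →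
             rank-injective b∈ b′∈ (trans (𝟙>0⇒ (at b r) p) (sym (𝟙>0⇒ (at b′ r) p′)))) ⟩
      length (upTo g) * 1
        ≡⟨ trans (*-identityʳ _) (length-upTo g) ⟩
      g ∎
      where
      open ≤-Reasoning
      at : ∀ b r → Dec (rank b ≡ r + q * g)
      at b r = rank b ≟ r + q * g

  module Incidence {n : ℕ} {a : Fin n → Carrier} (convex : Convex R n a) where

    I : List (Fin n)
    I = allFin n

    |I| : length I ≡ n
    |I| = length-tabulate id

    -- The number of representations of `x` as a - b with a in A and b in `B`.
    reps : List Carrier → Carrier → ℕ
    reps B x = ∑[ i ∈ I ] ∑[ b ∈ B ] 𝟙 (a i ≈? b ⊞ x)

    ⊞-cancel-same : ∀ {b b′ x y z} → y ≈ b ⊞ x → z ≈ b′ ⊞ x → y ≈ z → b ≈ b′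
    ⊞-cancel-same {b} {b′} {x} p q e = ⊞-cancelʳ x b b′ (≈-trans (≈-sym p) (≈-trans e q))

    reps≤n : ∀ {B} → Unique B → ∀ x → reps B x ≤ n
    reps≤n {B} uB x = ≤-trans (∑-≤-const I 1 row) (≤-reflexive (trans (*-identityʳ _) |I|))
      where
      row : ∀ i → ∑[ b ∈ B ] 𝟙 (a i ≈? b ⊞ x) ≤ 1
      row i = ∑≤1 uB (λ b _ → 𝟙≤1 (a i ≈? b ⊞ x)) λ b b′ _ _ p p′ →
        ⊞-cancel-same (𝟙>0⇒ (a i ≈? b ⊞ x) p) (𝟙>0⇒ (a i ≈? b′ ⊞ x) p′) ≈-refl

    reps≤length : ∀ B x → reps B x ≤ length B
    reps≤length B x = begin
      reps B x
        ≡⟨ ∑-swap I B _ ⟩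
      ∑[ b ∈ B ] ∑[ i ∈ I ] 𝟙 (a i ≈? b ⊞ x)
        ≤⟨ ∑-≤-const B 1 (λ b → ∑≤1 (allFin⁺ n) (λ i _ → 𝟙≤1 (a i ≈? b ⊞ x)) λ i j _ _ p q →
             a-injective convex (≈-trans (𝟙>0⇒ (a i ≈? b ⊞ x) p) (≈-sym (𝟙>0⇒ (a j ≈? b ⊞ x) q)))) ⟩
      length B * 1
        ≡⟨ *-identityʳ _ ⟩
      length B ∎
      where open ≤-Reasoning

    ∑reps≤ : ∀ B {X} → Unique X → ∑ X (reps B) ≤ n * length B
    ∑reps≤ B {X} uX = begin
      ∑ X (reps B)
        ≡⟨ ∑-swap X I _ ⟩
      ∑[ i ∈ I ] ∑[ x ∈ X ] ∑[ b ∈ B ] 𝟙 (a i ≈? b ⊞ x)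
        ≡⟨ ∑-cong I (λ i → ∑-swap X B _) ⟩
      ∑[ i ∈ I ] ∑[ b ∈ B ] ∑[ x ∈ X ] 𝟙 (a i ≈? b ⊞ x)
        ≤⟨ ∑-≤-const I (length B * 1) (λ i → ∑-≤-const B 1 λ b → ∑≤1 uX (λ x _ → 𝟙≤1 (a i ≈? b ⊞ x)) λ x y _ _ p q →
             ⊞-cancel-same (≈-trans (𝟙>0⇒ (a i ≈? b ⊞ x) p) (⊞-comm b x))
                           (≈-trans (𝟙>0⇒ (a i ≈? b ⊞ y) q) (⊞-comm b y)) ≈-refl) ⟩
      length I * (length B * 1)
        ≡⟨ cong₂ _*_ |I| (*-identityʳ _) ⟩
      n * length B ∎
      where open ≤-Reasoning

  ⊟≈⇒≈⊞ : ∀ {y z t} → y ⊟ z ≈ t → y ≈ z ⊞ t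
  ⊟≈⇒≈⊞ {y} {z} {t} e = ≈-trans (≈-sym (x⊟y⊞y≈x y z)) (≈-trans (⊞-cong e ≈-refl) (⊞-comm t z))

  ≈⊞⇒⊟≈ : ∀ {y z t} → y ≈ z ⊞ t → y ⊟ z ≈ t
  ≈⊞⇒⊟≈ {y} {z} {t} e = ⊞-cancelʳ z (y ⊟ z) t (≈-trans (x⊟y⊞y≈x y z) (≈-trans e (⊞-comm z t)))

  -- For fixed x the incidences aᵢ ≈ b ⊞ x increase in i and b together, so cutting the indices of A and the ranks of B
  -- into blocks leaves few colours; and i is recovered from (b , b′ , i′ − i) because the gaps a (i + k) − a i increase.
  module SzemerédiTrotter {n : ℕ} {a : Fin n → Carrier} (convex : Convex R n a)
                          {B : List Carrier} (uB : Unique B) {X : List Carrier} (uX : Unique X) where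
    open Incidence convex
    open Rank B

    module _ (h g : ℕ) .{{_ : NonZero h}} .{{_ : NonZero g}} where
      on? : ∀ x i → Dec (Any (λ b → a i ≈ b ⊞ x) B)
      on? x i = any? (λ b → a i ≈? b ⊞ x) B

      points : Carrier → List (Fin n)
      points x = filter (on? x) I

      -- The sum of the index block and the rank block. Both grow along the incidences of `x`, so
      -- the sum takes few values, about n / h + m / g, and still determines both blocks.
      colour : Carrier → Fin n → ℕ
      colour x i = toℕ i / h + rank (a i ⊟ x) / g

      pair? : ∀ x i i′ → Dec (colour x i ≡ colour x i′ × toℕ i < toℕ i′)
      pair? x i i′ = (colour x i ≟ colour x i′) ×-dec (toℕ i <? toℕ i′)

      pairs : Carrier → ℕ
      pairs x = ∑[ i ∈ points x ] ∑[ i′ ∈ points x ] 𝟙 (pair? x i i′)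

      -- An index lies on at most one incidence of `x`, so the count is that of `points x`; what
      -- exceeds the number of colours is paid for by monochromatic pairs. The `suc` counts colour
      -- 0.
      reps≤colours+pairs : ∀ x → reps B x ≤ suc (n / h + m / g) + pairs x
      reps≤colours+pairs x = begin
        reps B x
          ≤⟨ ∑-mono I (λ i → ∑𝟙≤𝟙 (λ b → a i ≈? b ⊞ x) (on? x i) uB
               (λ b b′ p p′ → ⊞-cancel-same p p′ ≈-refl) (λ b b∈ → lose b∈)) ⟩
        ∑[ i ∈ I ] 𝟙 (on? x i)
          ≡⟨ length-filter-∑ (on? x) I ⟨
        length (points x)
          ≤⟨ length≤colours+pairs (points x) toℕ (colour x) _
               (AllPairs.filter⁺ (on? x) (AllPairs.map (λ i≢j e → i≢j (toℕ-injective e)) (allFin⁺ n)))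
               (λ i _ → s≤s (+-mono-≤ (/-monoˡ-≤ h (<⇒≤ (toℕ<n i))) (/-monoˡ-≤ g (rank≤m (a i ⊟ x))))) ⟩
        suc (n / h + m / g) + pairs x ∎
        where open ≤-Reasoning

      block? : ∀ b b′ → Dec (rank b′ / g ≡ rank b / g)
      block? b b′ = rank b′ / g ≟ rank b / g

      config? : ∀ b b′ x i i′ k → Dec ((a i ≈ b ⊞ x × a i′ ≈ b′ ⊞ x) × toℕ i′ ≡ suc k + toℕ i)
      config? b b′ x i i′ k = ((a i ≈? b ⊞ x) ×-dec (a i′ ≈? b′ ⊞ x)) ×-dec (toℕ i′ ≟ suc k + toℕ i)

      BB : List (Carrier × Carrier)
      BB = cartesianProduct B B

      configs : Carrier → Fin n → Fin n → Carrier × Carrier → ℕ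
      configs x i i′ (b , b′) = 𝟙 (block? b b′) * ∑[ k ∈ upTo h ] 𝟙 (config? b b′ x i i′ k)

      -- A monochromatic pair stays within one index block and one rank block, so its index distance
      -- k + 1 has k < h, and its `b` and `b′` share a block.
      pairs≤configs : ∀ x → pairs x ≤ ∑[ i ∈ I ] ∑[ i′ ∈ I ] ∑ BB (configs x i i′)
      pairs≤configs x = ≤-trans (≤-reflexive (∑-filter (on? x) I _)) (∑-mono I λ i → 𝟙*≤ (on? x i) λ on →
        ≤-trans (≤-reflexive (∑-filter (on? x) I _)) (∑-mono I λ i′ → 𝟙*≤ (on? x i′) λ on′ →
          𝟙≤ (pair? x i i′) λ (c , lt) → pointwise i i′ (find on) (find on′) c lt))
        where
        open ≤-Reasoning
        pointwise : ∀ i i′ → (∃ λ b → b ∈ B × a i ≈ b ⊞ x) → (∃ λ b → b ∈ B × a i′ ≈ b ⊞ x) →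
                    colour x i ≡ colour x i′ → toℕ i < toℕ i′ → 1 ≤ ∑ BB (configs x i i′)
        pointwise i i′ (b , b∈ , e) (b′ , b′∈ , e′) c lt = begin
          1
            ≤⟨ 𝟙≥1 (config? b b′ x i i′ k) ((e , e′) , ik) ⟩
          𝟙 (config? b b′ x i i′ k)
            ≤⟨ term≤∑ (λ k → 𝟙 (config? b b′ x i i′ k)) (∈-upTo⁺ k<h) ⟩
          ∑[ k ∈ upTo h ] 𝟙 (config? b b′ x i i′ k)
            ≤⟨ ≤𝟙* (block? b b′) (sym (proj₂ same)) ⟩
          configs x i i′ (b , b′)
            ≤⟨ term≤∑ (λ b′ → configs x i i′ (b , b′)) b′∈ ⟩
          ∑[ b′ ∈ B ] configs x i i′ (b , b′)
            ≤⟨ term≤∑ (λ b → ∑[ b′ ∈ B ] configs x i i′ (b , b′)) b∈ ⟩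
          ∑[ b ∈ B ] ∑[ b′ ∈ B ] configs x i i′ (b , b′)
            ≡⟨ ∑-× B B (configs x i i′) ⟨
          ∑ BB (configs x i i′) ∎
          where
          rank-eq : ∀ {j d} → a j ≈ d ⊞ x → rank (a j ⊟ x) ≡ rank d
          rank-eq {j} {d} p = rank-cong (⊞-cancelʳ x _ _ (≈-trans (x⊟y⊞y≈x (a j) x) p))
          b≺b′ : b ≺ b′
          b≺b′ = ⊞-cancel-≺ x (≺-respʳ-≈ e′ (≺-respˡ-≈ e (a-mono convex lt)))
          same : toℕ i / h ≡ toℕ i′ / h × rank b / g ≡ rank b′ / g
          same = +-≡-≤⇒≡ (/-monoˡ-≤ h (<⇒≤ lt)) (/-monoˡ-≤ g (rank-mono b≺b′))
            (subst₂ (λ r r′ → toℕ i / h + r / g ≡ toℕ i′ / h + r′ / g) (rank-eq e) (rank-eq e′) c)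
          k : ℕ
          k = toℕ i′ ∸ suc (toℕ i)
          ik : toℕ i′ ≡ suc k + toℕ i
          ik = trans (sym (m∸n+n≡m lt)) (+-suc k (toℕ i))
          k<h : k < h
          k<h = +-cancelʳ-< (toℕ i) k h (≤-trans (≤-reflexive (sym ik))
            (<⇒≤ (subst (toℕ i′ <_) (+-comm (toℕ i) h) (/-same⇒< (toℕ i) (toℕ i′) h (proj₁ same)))))

      config-unique : ∀ b b′ k → ∑[ x ∈ X ] ∑[ i ∈ I ] ∑[ i′ ∈ I ] 𝟙 (config? b b′ x i i′ k) ≤ 1
      config-unique b b′ k = ∑≤1 uX
        (λ x _ → ∑≤1 (allFin⁺ n)
          (λ i _ → ∑≤1 (allFin⁺ n)
            (λ i′ _ → 𝟙≤1 (config? b b′ x i i′ k))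
            (λ i′ j′ _ _ p q → toℕ-injective (trans (proj₂ (𝟙>0⇒ (config? b b′ x i i′ k) p))
                                               (sym (proj₂ (𝟙>0⇒ (config? b b′ x i j′ k) q))))))
          (λ i j _ _ p q → proj₁ (determined (extract p) (extract q))))
        (λ x y _ _ p q → let (i , _ , p′) = ∑>0⇒∃ I p ; (j , _ , q′) = ∑>0⇒∃ I q in
          proj₂ (determined (extract p′) (extract q′)))
        where
        Config : Carrier → Fin n → Set
        Config x i = ∃ λ i′ → (a i ≈ b ⊞ x × a i′ ≈ b′ ⊞ x) × toℕ i′ ≡ suc k + toℕ i
        extract : ∀ {x i} → 0 < ∑[ i′ ∈ I ] 𝟙 (config? b b′ x i i′ k) → Config x i
        extract {x} {i} p = let (i′ , _ , q) = ∑>0⇒∃ I p in i′ , 𝟙>0⇒ (config? b b′ x i i′ k) q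
        determined : ∀ {x y i j} → Config x i → Config y j → i ≡ j × x ≈ y
        determined {x} {y} {i} {j} (i′ , (e , e′) , ik) (j′ , (f , f′) , jk) = i≡j , x≈y i≡j
          where
          i≡j : i ≡ j
          -- Both gaps equal b′ - b, since `x` and `y` cancel from their incidences.
          i≡j = gap-injective convex k ik jk (≈-trans (⊞-cong e′ f)
            (≈-trans (⊞-solve 4 (λ b b′ x y → (b′ ⊕ x) ⊕ (b ⊕ y) ⊜ (b′ ⊕ y) ⊕ (b ⊕ x)) ≈-refl b b′ x y)
              (≈-sym (⊞-cong f′ e))))
          x≈y : i ≡ j → x ≈ y
          x≈y refl = ⊞-cancel-same (≈-trans e (⊞-comm b x)) (≈-trans f (⊞-comm b y)) ≈-refl

      -- There are m choices of `b`, at most g of `b′` in its block and h of `k`; each triple occurs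
      -- in at most one configuration.
      ∑configs≤ : ∑[ x ∈ X ] ∑[ i ∈ I ] ∑[ i′ ∈ I ] ∑ BB (configs x i i′) ≤ m * (g * h)
      ∑configs≤ = begin
        ∑[ x ∈ X ] ∑[ i ∈ I ] ∑[ i′ ∈ I ] ∑ BB (configs x i i′)
          ≡⟨ ∑-swap₃ X I I BB configs ⟩
        ∑[ z ∈ BB ] ∑[ x ∈ X ] ∑[ i ∈ I ] ∑[ i′ ∈ I ] configs x i i′ z
          ≤⟨ ∑-mono BB perBlock ⟩
        ∑[ (b , b′) ∈ BB ] (𝟙 (block? b b′) * h)
          ≡⟨ trans (∑-× B B _) (∑-cong B (λ b → ∑-*ʳ B h _)) ⟩
        ∑[ b ∈ B ] (∑[ b′ ∈ B ] 𝟙 (block? b b′) * h)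
          ≤⟨ ∑-≤-const B (g * h) (λ b → *-monoˡ-≤ h (blockSize uB g (rank b / g))) ⟩
        m * (g * h) ∎
        where
        open ≤-Reasoning
        perBlock : ∀ ((b , b′) : Carrier × Carrier) →
          ∑[ x ∈ X ] ∑[ i ∈ I ] ∑[ i′ ∈ I ] configs x i i′ (b , b′) ≤ 𝟙 (block? b b′) * h
        perBlock (b , b′) = begin
          ∑[ x ∈ X ] ∑[ i ∈ I ] ∑[ i′ ∈ I ] (c * ∑[ k ∈ upTo h ] 𝟙 (config? b b′ x i i′ k))
            ≡⟨ trans (∑-cong X (λ x → trans (∑-cong I (λ i → ∑-*ˡ I c _)) (∑-*ˡ I c _))) (∑-*ˡ X c _) ⟩
          c * ∑[ x ∈ X ] ∑[ i ∈ I ] ∑[ i′ ∈ I ] ∑[ k ∈ upTo h ] 𝟙 (config? b b′ x i i′ k)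
            ≡⟨ cong (c *_) (∑-swap₃ X I I (upTo h) _) ⟩
          c * ∑[ k ∈ upTo h ] ∑[ x ∈ X ] ∑[ i ∈ I ] ∑[ i′ ∈ I ] 𝟙 (config? b b′ x i i′ k)
            ≤⟨ *-monoʳ-≤ c (∑-≤-const (upTo h) 1 (config-unique b b′)) ⟩
          c * (length (upTo h) * 1)
            ≡⟨ cong (c *_) (trans (*-identityʳ _) (length-upTo h)) ⟩
          c * h ∎
          where
          c : ℕ
          c = 𝟙 (block? b b′)

      cells : ∀ t → (∀ x → x ∈ X → t ≤ reps B x) →
              length X * t ≤ length X * suc (n / h + m / g) + m * (g * h)
      cells t rich = begin
        length X * t
          ≡⟨ ∑-const X t ⟨
        ∑[ _ ∈ X ] t
          ≤⟨ ∑-mono-∈ X (λ x x∈ → ≤-trans (rich x x∈) (≤-trans (reps≤colours+pairs x) (+-monoʳ-≤ _ (pairs≤configs x)))) ⟩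
        ∑[ x ∈ X ] (suc (n / h + m / g) + ∑[ i ∈ I ] ∑[ i′ ∈ I ] ∑ BB (configs x i i′))
          ≡⟨ ∑-+ X _ _ ⟩
        ∑[ x ∈ X ] suc (n / h + m / g) + ∑[ x ∈ X ] ∑[ i ∈ I ] ∑[ i′ ∈ I ] ∑ BB (configs x i i′)
          ≤⟨ +-mono-≤ (≤-reflexive (∑-const X _)) ∑configs≤ ⟩
        length X * suc (n / h + m / g) + m * (g * h) ∎
        where open ≤-Reasoning

    -- With q = t / 4 and blocks of lengths about m / q and n / q there are at most 2 q ≤ t / 2
    -- colours. Half of |X| t is therefore left to the pairs, which number at most m g h. For t < 4
    -- the trivial bound |X| t ≤ n m is enough.
    szemerédiTrotter : ∀ t → (∀ x → x ∈ X → t ≤ reps B x) → length X * (t * t * t) ≤ C * (n * (m * m))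
    szemerédiTrotter t rich with t <? 4
    ... | yes t<4 = begin
      length X * (t * t * t)             ≡⟨ regroup (length X) t ⟩
      t * t * (length X * t)             ≤⟨ *-mono-≤ (*-mono-≤ t≤3 t≤3) total ⟩
      9 * (n * m)                        ≤⟨ *-mono-≤ 9≤C (*-monoʳ-≤ n (m≤m*m m)) ⟩
      C * (n * (m * m))                  ∎
      where
      open ≤-Reasoning
      t≤3 : t ≤ 3
      t≤3 = s≤s⁻¹ t<4
      regroup : ∀ x t → x * (t * t * t) ≡ t * t * (x * t)
      regroup = solve-∀
      m≤m*m : ∀ m → m ≤ m * m
      m≤m*m zero    = z≤n
      m≤m*m (suc m) = m≤m*n (suc m) (suc m)
      total : length X * t ≤ n * m
      total = ≤-trans (≤-reflexive (sym (∑-const X t))) (≤-trans (∑-mono-∈ X rich) (∑reps≤ B uX))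
    -- A member of `X` gives t ≤ n and t ≤ m, hence q ≤ n and q ≤ m, so that rounding the block
    -- lengths up at most doubles them.
    ... | no ¬t<4 with empty⊎∃∈ X
    ...   | inj₁ X≡0      = ≤-trans (≤-reflexive (cong (_* (t * t * t)) X≡0)) z≤n
    ...   | inj₂ (x , x∈) = begin
      length X * (t * t * t)
        -- Replacing t by 8 q costs 8³ = 512; with the 2 of `reduced′` this is the constant `C`.
        ≤⟨ *-monoʳ-≤ (length X) (*-mono-≤ (*-mono-≤ t≤8q t≤8q) t≤8q) ⟩
      length X * (8 * q * (8 * q) * (8 * q))
        ≡⟨ regroup 8 (length X) q ⟩
      512 * (length X * (q * q * q))
        ≤⟨ *-monoʳ-≤ 512 reduced′ ⟩
      512 * (2 * (n * (m * m)))
        ≡⟨ trans (sym (*-assoc 512 2 (n * (m * m)))) (cong (_* (n * (m * m))) C≡) ⟩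
      C * (n * (m * m)) ∎
      where
      open ≤-Reasoning
      q : ℕ
      q = t / 4
      q≥1 : 1 ≤ q
      q≥1 = m≥n⇒m/n>0 (≮⇒≥ ¬t<4)
      instance
        q≢0 : NonZero q
        q≢0 = >-nonZero q≥1
      g h : ℕ
      g = suc (m / q)
      h = suc (n / q)
      4q≤t : 4 * q ≤ t
      4q≤t = ≤-trans (≤-reflexive (*-comm 4 q)) (m/n*n≤m t 4)
      t≤8q : t ≤ 8 * q
      t≤8q = begin
        t                   ≡⟨ m≡m%n+[m/n]*n t 4 ⟩
        t % 4 + q * 4       ≤⟨ +-monoˡ-≤ (q * 4) (≤-trans (<⇒≤ (m%n<n t 4)) (*-monoˡ-≤ 4 q≥1)) ⟩
        q * 4 + q * 4       ≡⟨ double q ⟩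
        8 * q               ∎
        where
        double : ∀ q → q * 4 + q * 4 ≡ 8 * q
        double = solve-∀
      q≤t : q ≤ t
      q≤t = ≤-trans (m≤n*m q 4) 4q≤t
      q≤n : q ≤ n
      q≤n = ≤-trans q≤t (≤-trans (rich x x∈) (reps≤n uB x))
      q≤m : q ≤ m
      q≤m = ≤-trans q≤t (≤-trans (rich x x∈) (reps≤length B x))
      blockLength : ∀ k → q ≤ k → suc (k / q) * q ≤ 2 * k
      blockLength k q≤k = +-mono-≤ q≤k (≤-trans (m/n*n≤m k q) (≤-reflexive (sym (+-identityʳ k))))
      few : ∀ k → k / suc (k / q) < q
      few k = m<n*o⇒m/o<n (begin-strict
        k                      ≡⟨ m≡m%n+[m/n]*n k q ⟩
        k % q + k / q * q      <⟨ +-monoˡ-< (k / q * q) (m%n<n k q) ⟩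
        suc (k / q) * q        ≡⟨ *-comm (suc (k / q)) q ⟩
        q * suc (k / q)        ∎)
      reduced : length X * (2 * q) ≤ m * (g * h)
      reduced = +-cancelˡ-≤ (length X * (2 * q)) _ _ (begin
        length X * (2 * q) + length X * (2 * q)             ≡⟨ double (length X) q ⟩
        length X * (4 * q)                                  ≤⟨ *-monoʳ-≤ (length X) 4q≤t ⟩
        length X * t                                        ≤⟨ cells h g t rich ⟩
        length X * suc (n / h + m / g) + m * (g * h)
          ≤⟨ +-monoˡ-≤ (m * (g * h)) (*-monoʳ-≤ (length X)
               (+-mono-≤ (few n) (≤-trans (<⇒≤ (few m)) (≤-reflexive (sym (+-identityʳ q)))))) ⟩
        length X * (2 * q) + m * (g * h)                    ∎)
        where
        double : ∀ x q → x * (2 * q) + x * (2 * q) ≡ x * (4 * q)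
        double = solve-∀
      reduced′ : length X * (q * q * q) ≤ 2 * (n * (m * m))
      reduced′ = *-cancelˡ-≤ 2 (begin
        2 * (length X * (q * q * q))             ≡⟨ regroup₁ (length X) q ⟩
        length X * (2 * q) * (q * q)             ≤⟨ *-monoˡ-≤ (q * q) reduced ⟩
        m * (g * h) * (q * q)                    ≡⟨ regroup₂ m g h q ⟩
        m * (g * q * (h * q))                    ≤⟨ *-monoʳ-≤ m (*-mono-≤ (blockLength m q≤m) (blockLength n q≤n)) ⟩
        m * (2 * m * (2 * n))                    ≡⟨ regroup₃ m n ⟩
        2 * (2 * (n * (m * m)))                  ∎)
        where
        regroup₁ : ∀ x q → 2 * (x * (q * q * q)) ≡ x * (2 * q) * (q * q)
        regroup₁ = solve-∀
        regroup₂ : ∀ m g h q → m * (g * h) * (q * q) ≡ m * (g * q * (h * q))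
        regroup₂ = solve-∀
        regroup₃ : ∀ m n → m * (2 * m * (2 * n)) ≡ 2 * (2 * (n * (m * m)))
        regroup₃ = solve-∀
      regroup : ∀ e x q → x * (e * q * (e * q) * (e * q)) ≡ e * e * e * (x * (q * q * q))
      regroup = solve-∀

-- Third moment of the difference counts, and dyadic levels of a mixed count.

module Energy (R : RealField 0ℓ 0ℓ) where
  open Sumsets R

  ≈-decSetoid : DecSetoid 0ℓ 0ℓ
  ≈-decSetoid = record { isDecEquivalence = record
    { isEquivalence = record { refl = ≈-refl ; sym = ≈-sym ; trans = ≈-trans } ; _≟_ = _≈?_ } }

  dedup : List Carrier → List Carrier
  dedup = deduplicate _≈?_

  dedup-unique : ∀ xs → Unique (dedup xs)
  dedup-unique = deduplicate-! ≈-decSetoid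

  dedup⁺ : ∀ {z xs} → Any (z ≈_) xs → Any (z ≈_) (dedup xs)
  dedup⁺ = Any.deduplicate⁺ _≈?_ (λ x≈y z≈x → ≈-trans z≈x (≈-sym x≈y))

  -- Groups the terms by the value of `φ`, with one representative for each class of `≈`; hence `F`
  -- must respect `≈`.
  ∑-fibres : ∀ {A : Set} (ps : List A) (φ : A → Carrier) (F : Carrier → ℕ) → (∀ {x y} → x ≈ y → F x ≤ F y) →
    ∑[ p ∈ ps ] F (φ p) ≤ ∑[ t ∈ dedup (map φ ps) ] (∑[ p ∈ ps ] 𝟙 (φ p ≈? t) * F t)
  ∑-fibres ps φ F F-resp = begin
    ∑[ p ∈ ps ] F (φ p)
      ≤⟨ ∑-mono-∈ ps covered ⟩
    ∑[ p ∈ ps ] ∑[ t ∈ T ] (𝟙 (φ p ≈? t) * F t)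
      ≡⟨ ∑-swap ps T _ ⟩
    ∑[ t ∈ T ] ∑[ p ∈ ps ] (𝟙 (φ p ≈? t) * F t)
      ≡⟨ ∑-cong T (λ t → ∑-*ʳ ps (F t) _) ⟩
    ∑[ t ∈ T ] (∑[ p ∈ ps ] 𝟙 (φ p ≈? t) * F t) ∎
    where
    open ≤-Reasoning
    T : List Carrier
    T = dedup (map φ ps)
    covered : ∀ p → p ∈ ps → F (φ p) ≤ ∑[ t ∈ T ] (𝟙 (φ p ≈? t) * F t)
    covered p p∈ with find (dedup⁺ (lose (∈-map⁺ φ p∈) ≈-refl))
    ... | t , t∈ , e = ≤-trans (F-resp e) (≤-trans (≤𝟙* (φ p ≈? t) e) (term≤∑ (λ t → 𝟙 (φ p ≈? t) * F t) t∈))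

  module _ {n : ℕ} {a : Fin n → Carrier} (convex : Convex R n a) where
    open Incidence convex

    reps-resp : ∀ B {x y} → x ≈ y → reps B x ≤ reps B y
    reps-resp B {x} {y} e = ∑-mono I λ i → ∑-mono B λ b →
      𝟙≤ (a i ≈? b ⊞ x) λ p → 𝟙≥1 (a i ≈? b ⊞ y) (≈-trans p (⊞-cong ≈-refl e))

    A : List Carrier
    A = map a I

    A-unique : Unique A
    A-unique = AllPairs.map⁺ (AllPairs.map (λ i≢j e → i≢j (a-injective convex e)) (allFin⁺ n))

    |A| : length A ≡ n
    |A| = trans (length-map a I) |I|

    ρ : Fin n → Fin n → ℕ
    ρ i j = reps A (a i ⊟ a j)

    -- The third moment ∑ r³ over A - A: a difference d arises from r(d) pairs (i , j), each
    -- contributing r(d)².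
    E₃ : ℕ
    E₃ = ∑[ i ∈ I ] ∑[ j ∈ I ] (ρ i j * ρ i j)

    fibre≤reps : ∀ (B : List Carrier) t → ∑[ (i , b) ∈ cartesianProduct I B ] 𝟙 (a i ⊟ b ≈? t) ≤ reps B t
    fibre≤reps B t = ≤-trans (≤-reflexive (∑-× I B _)) (∑-mono I λ i → ∑-mono B λ b →
      𝟙≤ (a i ⊟ b ≈? t) λ e → 𝟙≥1 (a i ≈? b ⊞ t) (⊟≈⇒≈⊞ e))

    -- The incidence bound allows at most C n³ / 2 ^ (3 j) differences with r ≥ 2 ^ j. Each of the l
    -- levels thus contributes at most 8 C n³, where 8 = 2³ pays for rounding r up to 2 ^ (j + 1).
    E₃≤ : ∀ l → n < 2 ^ l → E₃ ≤ K * (l * (n * n * n))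
    E₃≤ l n<2^l = begin
      E₃
        ≡⟨ trans (∑-cong I (λ i → sym (∑-map I a (λ b → F (a i ⊟ b))))) (sym (∑-× I A _)) ⟩
      ∑[ (i , b) ∈ IA ] F (a i ⊟ b)
        ≤⟨ ∑-fibres IA φ F (λ e → *-mono-≤ (reps-resp A e) (reps-resp A e)) ⟩
      ∑[ t ∈ V ] (∑[ p ∈ IA ] 𝟙 (φ p ≈? t) * F t)
        ≤⟨ ∑-mono V (λ t → ≤-trans (*-monoˡ-≤ (F t) (fibre≤reps A t)) (cube t)) ⟩
      ∑[ t ∈ V ] ∑[ j ∈ upTo l ] (𝟙 (2 ^ j ≤? reps A t) * (2 ^ suc j) ^ 3)
        ≡⟨ ∑-swap V (upTo l) _ ⟩
      ∑[ j ∈ upTo l ] ∑[ t ∈ V ] (𝟙 (2 ^ j ≤? reps A t) * (2 ^ suc j) ^ 3)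
        ≤⟨ ∑-≤-const (upTo l) (K * (n * n * n)) perLevel ⟩
      length (upTo l) * (K * (n * n * n))
        ≡⟨ cong (_* (K * (n * n * n))) (length-upTo l) ⟩
      l * (K * (n * n * n))
        ≡⟨ swap l K (n * n * n) ⟩
      K * (l * (n * n * n)) ∎
      where
      open ≤-Reasoning
      swap : ∀ a b c → a * (b * c) ≡ b * (a * c)
      swap = solve-∀
      IA : List (Fin n × Carrier)
      IA = cartesianProduct I A
      φ : Fin n × Carrier → Carrier
      φ (i , b) = a i ⊟ b
      V : List Carrier
      V = dedup (map φ IA)
      F : Carrier → ℕ
      F t = reps A t * reps A t
      cube : ∀ t → reps A t * F t ≤ ∑[ j ∈ upTo l ] (𝟙 (2 ^ j ≤? reps A t) * (2 ^ suc j) ^ 3)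
      cube t = ≤-trans (≤-reflexive (cong (λ x → reps A t * (reps A t * x)) (sym (*-identityʳ _))))
                       (dyadic l 2 (reps A t) (≤-<-trans (reps≤n A-unique t) n<2^l))
      perLevel : ∀ j → ∑[ t ∈ V ] (𝟙 (2 ^ j ≤? reps A t) * (2 ^ suc j) ^ 3) ≤ K * (n * n * n)
      perLevel j = begin
        ∑[ t ∈ V ] (𝟙 (rich? t) * (2 ^ suc j) ^ 3)
          ≡⟨ trans (∑-*ʳ V _ _) (cong (_* (2 ^ suc j) ^ 3) (sym (length-filter-∑ rich? V))) ⟩
        length Vⱼ * (2 ^ suc j) ^ 3
          ≡⟨ eight (length Vⱼ) (2 ^ j) ⟩
        8 * (length Vⱼ * (2 ^ j * 2 ^ j * 2 ^ j))
          ≤⟨ *-monoʳ-≤ 8 (SzemerédiTrotter.szemerédiTrotter convex A-unique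
               (AllPairs.filter⁺ rich? (dedup-unique (map φ IA))) (2 ^ j) (λ x x∈ → proj₂ (∈-filter⁻ rich? {xs = V} x∈))) ⟩
        8 * (C * (n * (length A * length A)))
          ≡⟨ trans (cong (λ k → 8 * (C * (n * (k * k)))) |A|) (trans (collect C n) (cong (_* (n * n * n)) K≡8C)) ⟩
        K * (n * n * n) ∎
        where
        rich? : ∀ t → Dec (2 ^ j ≤ reps A t)
        rich? t = 2 ^ j ≤? reps A t
        Vⱼ : List Carrier
        Vⱼ = filter rich? V
        eight : ∀ x y → x * (2 * y * (2 * y * (2 * y * 1))) ≡ 8 * (x * (y * y * y))
        eight = solve-∀
        collect : ∀ C n → 8 * (C * (n * (n * n))) ≡ 8 * C * (n * n * n)
        collect = solve-∀

    -- The number of solutions of a i + a j ≈ y + d with y in `P` and d in `D`, counted for each j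
    -- and y by the representations of -(a j - y).
    mixed : (P D : List Carrier) → ℕ
    mixed P D = ∑[ (j , y) ∈ cartesianProduct I P ] reps D (⊟ (a j ⊟ y))

    module _ {P D : List Carrier} (uP : Unique P) (uD : Unique D) where

      -- Here `m` values t satisfy r_{A-P}(t) ≥ u and r_{A-D}(-t) ≥ v, and they account for a 1 / l²
      -- share of `mixed`, up to a constant.
      record DyadicLevel (l : ℕ) : Set where
        field
          u v m   : ℕ
          mixed≤  : mixed P D ≤ 4 * (l * l * (u * v * m))
          mu³≤    : m * (u * u * u) ≤ C * (n * (length P * length P))
          mv≤     : m * v ≤ n * length D
          mv³≤    : m * (v * v * v) ≤ C * (n * (length D * length D))

      -- Grouping by t = a j - y turns `mixed` into a sum of products f(t) g(t). Both factors are
      -- decomposed dyadically, at the cost of 2 each, and the best of the l² pairs of levels is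
      -- kept.
      ∃-level : ∀ l → 0 < l → n < 2 ^ l → DyadicLevel l
      ∃-level l 0<l n<2^l = record
        { u = 2 ^ i ; v = 2 ^ j ; m = length X
        ; mixed≤ = total
        ; mu³≤ = SzemerédiTrotter.szemerédiTrotter convex uP uX (2 ^ i) (λ x x∈ → proj₁ (proj₂ (∈-filter⁻ (rich? i j) {xs = T} x∈)))
        ; mv≤ = ≤-trans (≤-reflexive (trans (cong (_* 2 ^ j) (sym |X⁻|)) (sym (∑-const X⁻ _))))
                  (≤-trans (∑-mono-∈ X⁻ rich⁻) (∑reps≤ D uX⁻))
        ; mv³≤ = subst (λ k → k * (2 ^ j * 2 ^ j * 2 ^ j) ≤ C * (n * (length D * length D))) |X⁻|
                  (SzemerédiTrotter.szemerédiTrotter convex uD uX⁻ (2 ^ j) rich⁻)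
        }
        where
        open ≤-Reasoning
        IP : List (Fin n × Carrier)
        IP = cartesianProduct I P
        φ : Fin n × Carrier → Carrier
        φ (i , y) = a i ⊟ y
        T : List Carrier
        T = dedup (map φ IP)
        f g : Carrier → ℕ
        f t = reps P t
        g t = reps D (⊟ t)
        LL : List (ℕ × ℕ)
        LL = cartesianProduct (upTo l) (upTo l)
        rich? : ∀ i j t → Dec (2 ^ i ≤ f t × 2 ^ j ≤ g t)
        rich? i j t = (2 ^ i ≤? f t) ×-dec (2 ^ j ≤? g t)
        term : ℕ × ℕ → ℕ
        term (i , j) = length (filter (rich? i j) T) * (4 * (2 ^ i * 2 ^ j))
        product : ∀ t → f t * g t ≤ ∑[ (i , j) ∈ LL ] (𝟙 (rich? i j t) * (4 * (2 ^ i * 2 ^ j)))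
        product t = begin
          f t * g t
            ≡⟨ cong₂ _*_ (sym (*-identityʳ (f t))) (sym (*-identityʳ (g t))) ⟩
          f t ^ 1 * g t ^ 1
            ≤⟨ *-mono-≤ (dyadic l 0 (f t) (≤-<-trans (reps≤n uP t) n<2^l)) (dyadic l 0 (g t) (≤-<-trans (reps≤n uD (⊟ t)) n<2^l)) ⟩
          ∑[ i ∈ upTo l ] (𝟙 (2 ^ i ≤? f t) * (2 ^ suc i) ^ 1) * ∑[ j ∈ upTo l ] (𝟙 (2 ^ j ≤? g t) * (2 ^ suc j) ^ 1)
            ≡⟨ trans (∑*∑ (upTo l) (upTo l) _ _) (sym (∑-× (upTo l) (upTo l) _)) ⟩
          ∑[ (i , j) ∈ LL ] (𝟙 (2 ^ i ≤? f t) * (2 ^ suc i) ^ 1 * (𝟙 (2 ^ j ≤? g t) * (2 ^ suc j) ^ 1))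
            ≤⟨ ∑-mono LL (λ (i , j) → ≤-trans (≤-reflexive (regroup (𝟙 (2 ^ i ≤? f t)) (2 ^ i) (𝟙 (2 ^ j ≤? g t)) (2 ^ j)))
                 (𝟙*≤ (2 ^ i ≤? f t) λ p → 𝟙*≤ (2 ^ j ≤? g t) λ q → ≤𝟙* (rich? i j t) (p , q))) ⟩
          ∑[ (i , j) ∈ LL ] (𝟙 (rich? i j t) * (4 * (2 ^ i * 2 ^ j))) ∎
          where
          regroup : ∀ b x c y → b * (2 * x * 1) * (c * (2 * y * 1)) ≡ b * (c * (4 * (x * y)))
          regroup = solve-∀
        mixed≤∑ : mixed P D ≤ ∑ LL term
        mixed≤∑ = begin
          mixed P D
            ≤⟨ ∑-fibres IP φ g (λ e → reps-resp D (-‿cong e)) ⟩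
          ∑[ t ∈ T ] (∑[ p ∈ IP ] 𝟙 (φ p ≈? t) * g t)
            ≤⟨ ∑-mono T (λ t → ≤-trans (*-monoˡ-≤ (g t) (fibre≤reps P t)) (product t)) ⟩
          ∑[ t ∈ T ] ∑[ (i , j) ∈ LL ] (𝟙 (rich? i j t) * (4 * (2 ^ i * 2 ^ j)))
            ≡⟨ ∑-swap T LL _ ⟩
          ∑[ (i , j) ∈ LL ] ∑[ t ∈ T ] (𝟙 (rich? i j t) * (4 * (2 ^ i * 2 ^ j)))
            ≡⟨ ∑-cong LL (λ (i , j) → trans (∑-*ʳ T _ _) (cong (_* (4 * (2 ^ i * 2 ^ j))) (sym (length-filter-∑ (rich? i j) T)))) ⟩
          ∑ LL term ∎
        |LL| : length LL ≡ l * l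
        |LL| = trans (length-× (upTo l) (upTo l)) (cong₂ _*_ (length-upTo l) (length-upTo l))
        best : ∃ λ ij → ij ∈ LL × ∑ LL term ≤ length LL * term ij
        best = ∑≤length*max LL term (subst (0 <_) (sym |LL|) (*-mono-< 0<l 0<l))
        i j : ℕ
        i = proj₁ (proj₁ best)
        j = proj₂ (proj₁ best)
        X X⁻ : List Carrier
        X  = filter (rich? i j) T
        -- `g` is a representation count at -t, so the bounds for `D` are applied to the negatives.
        X⁻ = map ⊟_ X
        total : mixed P D ≤ 4 * (l * l * (2 ^ i * 2 ^ j * length X))
        total = begin
          mixed P D                                              ≤⟨ mixed≤∑ ⟩
          ∑ LL term                                          ≤⟨ proj₂ (proj₂ best) ⟩
          length LL * (length X * (4 * (2 ^ i * 2 ^ j)))     ≡⟨ cong (_* (length X * (4 * (2 ^ i * 2 ^ j)))) |LL| ⟩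
          l * l * (length X * (4 * (2 ^ i * 2 ^ j)))         ≡⟨ regroup (l * l) (length X) (2 ^ i * 2 ^ j) ⟩
          4 * (l * l * (2 ^ i * 2 ^ j * length X))           ∎
          where
          regroup : ∀ a b c → a * (b * (4 * c)) ≡ 4 * (a * (c * b))
          regroup = solve-∀
        uX : Unique X
        uX = AllPairs.filter⁺ (rich? i j) (dedup-unique (map φ IP))
        uX⁻ : Unique X⁻
        uX⁻ = AllPairs.map⁺ (AllPairs.map (λ x≉y e → x≉y (-‿injective e)) uX)
        |X⁻| : length X⁻ ≡ length X
        |X⁻| = length-map ⊟_ X
        rich⁻ : ∀ x → x ∈ X⁻ → 2 ^ j ≤ reps D x
        rich⁻ x x∈ with ∈-map⁻ ⊟_ x∈
        ... | t , t∈ , refl = proj₂ (proj₂ (∈-filter⁻ (rich? i j) {xs = T} t∈))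

-- Popular sums, rich differences and the conclusion.

module PopularSums (R : RealField 0ℓ 0ℓ) where
  open Sumsets R
  open Energy R

  module _ {n : ℕ} {a : Fin n → Carrier} (convex : Convex R n a) (n>0 : 0 < n)
           {S : List Carrier} (uS : Unique S) (cover : ∀ i j → Any (a i ⊞ a j ≈_) S) where
    open Incidence convex
    open ≤-Reasoning

    private
      instance
        n≢0 : NonZero n
        n≢0 = >-nonZero n>0

    s : ℕ
    s = length S

    s>0 : 0 < s
    s>0 = nonempty (cover i₀ i₀)
      where
      i₀ : Fin n
      i₀ = fromℕ< n>0
      nonempty : ∀ {z xs} → Any (z ≈_) xs → 0 < length xs
      nonempty (here _)  = z<s
      nonempty (there _) = z<s

    sums : Carrier → ℕ
    sums x = ∑[ i ∈ I ] ∑[ j ∈ I ] 𝟙 (a i ⊞ a j ≈? x)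

    -- The threshold is an eighth of the average multiplicity n² / s.
    popular? : ∀ x → Dec (n * n ≤ 8 * (s * sums x))
    popular? x = n * n ≤? 8 * (s * sums x)

    P : List Carrier
    P = filter popular? S

    P-unique : Unique P
    P-unique = AllPairs.filter⁺ popular? uS

    inP? : ∀ z → Dec (Any (z ≈_) P)
    inP? z = any? (z ≈?_) P

    bad : Fin n → ℕ
    bad b = ∑[ i ∈ I ] 𝟙 (¬? (inP? (a i ⊞ a b)))

    -- An unpopular sum accounts for fewer than n² / 8s pairs, and there are at most s of them.
    8∑bad≤n² : 8 * ∑ I bad ≤ n * n
    8∑bad≤n² = *-cancelˡ-≤ s {{>-nonZero s>0}} (begin
      s * (8 * ∑ I bad)
        ≤⟨ *-monoʳ-≤ s (*-monoʳ-≤ 8 (∑-mono I λ b → ∑-mono I λ i → 𝟙≤ (¬? (inP? (a i ⊞ a b))) (unpopular b i))) ⟩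
      s * (8 * ∑[ b ∈ I ] ∑[ i ∈ I ] ∑[ x ∈ S ] term x b i)
        ≡⟨ cong (λ z → s * (8 * z)) (trans (∑-cong I (λ b → ∑-swap I S _)) (∑-swap I S _)) ⟩
      s * (8 * ∑[ x ∈ S ] ∑[ b ∈ I ] ∑[ i ∈ I ] term x b i)
        ≡⟨ cong (λ z → s * (8 * z)) (∑-cong S λ x →
             trans (∑-cong I (λ b → ∑-*ˡ I (no? x) _)) (trans (∑-*ˡ I (no? x) _) (cong (no? x *_) (∑-swap I I _)))) ⟩
      s * (8 * ∑[ x ∈ S ] (no? x * sums x))
        ≡⟨ trans (sym (*-assoc s 8 _)) (sym (∑-*ˡ S (s * 8) _)) ⟩
      ∑[ x ∈ S ] (s * 8 * (no? x * sums x))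
        ≤⟨ ∑-≤-const S (n * n) (λ x → ≤-trans (≤-reflexive (regroup s (no? x) (sums x)))
             (𝟙*≤ (¬? (popular? x)) λ np → <⇒≤ (≰⇒> np))) ⟩
      s * (n * n) ∎)
      where
      no? : Carrier → ℕ
      no? x = 𝟙 (¬? (popular? x))
      term : Carrier → Fin n → Fin n → ℕ
      term x b i = no? x * 𝟙 (a i ⊞ a b ≈? x)
      regroup : ∀ s x y → s * 8 * (x * y) ≡ x * (8 * (s * y))
      regroup = solve-∀
      unpopular : ∀ b i → ¬ Any (a i ⊞ a b ≈_) P → 1 ≤ ∑[ x ∈ S ] term x b i
      unpopular b i ∉P = let (x , x∈ , e) = find (cover i b) in
        ≤-trans (≤-trans (𝟙≥1 (a i ⊞ a b ≈? x) e)
          (≤𝟙* (¬? (popular? x)) λ p → ∉P (lose (∈-filter⁺ popular? x∈ p) e))) (term≤∑ (λ x → term x b i) x∈)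

    -- A quarter, so that the bad indices of two good elements together leave half of A.
    good? : ∀ b → Dec (4 * bad b ≤ n)
    good? b = 4 * bad b ≤? n

    A′ : List (Fin n)
    A′ = filter good? I

    k : ℕ
    k = length A′

    -- Markov's inequality: each exception has more than n / 4 bad indices out of a total of n² / 8.
    n≤2k : n ≤ 2 * k
    n≤2k = +-cancelʳ-≤ n n (2 * k) (begin
      n + n                       ≡⟨ cong (n +_) (sym (+-identityʳ n)) ⟩
      2 * n                       ≤⟨ *-monoʳ-≤ 2 n≤k+exceptions ⟩
      2 * (k + exceptions)        ≡⟨ *-distribˡ-+ 2 k exceptions ⟩
      2 * k + 2 * exceptions      ≤⟨ +-monoʳ-≤ (2 * k) 2exceptions≤n ⟩
      2 * k + n                   ∎)
      where
      exceptions : ℕ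
      exceptions = ∑[ b ∈ I ] 𝟙 (¬? (good? b))
      n≤k+exceptions : n ≤ k + exceptions
      n≤k+exceptions = begin
        n                                                  ≡⟨ trans (sym |I|) (length-as-∑ I) ⟩
        ∑[ b ∈ I ] 1                                       ≤⟨ ∑-mono I (λ b → 1≤𝟙+𝟙¬ (good? b)) ⟩
        ∑[ b ∈ I ] (𝟙 (good? b) + 𝟙 (¬? (good? b)))        ≡⟨ ∑-+ I _ _ ⟩
        ∑[ b ∈ I ] 𝟙 (good? b) + exceptions                ≡⟨ cong (_+ exceptions) (sym (length-filter-∑ good? I)) ⟩
        k + exceptions                                     ∎
      2exceptions≤n : 2 * exceptions ≤ n
      2exceptions≤n = *-cancelˡ-≤ n (begin
        n * (2 * exceptions)                               ≡⟨ regroup n exceptions ⟩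
        2 * (exceptions * n)                               ≡⟨ cong (2 *_) (sym (∑-*ʳ I n _)) ⟩
        2 * ∑[ b ∈ I ] (𝟙 (¬? (good? b)) * n)              ≤⟨ *-monoʳ-≤ 2 (∑-mono I λ b → 𝟙*≤ (¬? (good? b)) λ nb → <⇒≤ (≰⇒> nb)) ⟩
        2 * ∑[ b ∈ I ] (4 * bad b)                         ≡⟨ trans (cong (2 *_) (∑-*ˡ I 4 bad)) (regroup′ (∑ I bad)) ⟩
        8 * ∑ I bad                                        ≤⟨ 8∑bad≤n² ⟩
        n * n                                              ∎)
        where
        regroup : ∀ n e → n * (2 * e) ≡ 2 * (e * n)
        regroup = solve-∀
        regroup′ : ∀ x → 2 * (4 * x) ≡ 8 * x
        regroup′ = solve-∀

    r′ : Carrier → ℕ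
    r′ z = ∑[ b ∈ A′ ] ∑[ c ∈ A′ ] 𝟙 (a b ≈? a c ⊞ z)

    r′-resp : ∀ {x y} → x ≈ y → r′ x ≤ r′ y
    r′-resp {x} {y} e = ∑-mono A′ λ b → ∑-mono A′ λ c →
      𝟙≤ (a b ≈? a c ⊞ x) λ p → 𝟙≥1 (a b ≈? a c ⊞ y) (≈-trans p (⊞-cong ≈-refl e))

    ∑A′≤ : ∀ (f : Fin n → ℕ) → ∑ A′ f ≤ ∑ I f
    ∑A′≤ = ∑-filter-≤ good? I

    r′≤reps : ∀ z → r′ z ≤ reps (A convex) z
    r′≤reps z = begin
      r′ z                                                    ≤⟨ ∑-mono A′ (λ b → ∑A′≤ _) ⟩
      ∑[ b ∈ A′ ] ∑[ c ∈ I ] 𝟙 (a b ≈? a c ⊞ z)               ≤⟨ ∑A′≤ _ ⟩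
      ∑[ b ∈ I ] ∑[ c ∈ I ] 𝟙 (a b ≈? a c ⊞ z)                ≡⟨ ∑-cong I (λ b → sym (∑-map I a _)) ⟩
      reps (A convex) z                                       ∎

    AA : List (Fin n × Fin n)
    AA = cartesianProduct A′ A′

    δ σ : Fin n × Fin n → Carrier
    δ (b , c) = a b ⊟ a c
    σ (b , c) = a b ⊞ a c

    ∑AA≤ : ∀ (f : Fin n × Fin n → ℕ) → ∑ AA f ≤ ∑[ b ∈ I ] ∑[ c ∈ I ] f (b , c)
    ∑AA≤ f = ≤-trans (≤-reflexive (∑-× A′ A′ f)) (≤-trans (∑A′≤ _) (∑-mono I (λ b → ∑A′≤ _)))

    -- The additive energy of `A′`, written through differences.
    E′ : ℕ
    E′ = ∑[ p ∈ AA ] r′ (δ p)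

    -- Cauchy-Schwarz for the k² pairs distributed over s sums. Coincidences b + c ≈ b′ + c′ are
    -- then read as c′ - c ≈ b - b′.
    k⁴≤sE′ : k * k * (k * k) ≤ s * E′
    k⁴≤sE′ = begin
      k * k * (k * k)
        ≤⟨ *-mono-≤ k²≤ k²≤ ⟩
      ∑[ x ∈ S ] (1 * R′ x) * ∑[ x ∈ S ] (1 * R′ x)
        ≤⟨ cauchySchwarz S (λ _ → 1) R′ ⟩
      ∑[ x ∈ S ] 1 * ∑[ x ∈ S ] (R′ x * R′ x)
        ≡⟨ cong (_* ∑[ x ∈ S ] (R′ x * R′ x)) (sym (length-as-∑ S)) ⟩
      s * ∑[ x ∈ S ] (R′ x * R′ x)
        ≤⟨ *-monoʳ-≤ s (∑-collisions AA S (λ p x → σ p ≈? x) (λ p q → σ p ≈? σ q)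
             (λ p → ∑≤1 uS (λ x _ → 𝟙≤1 (σ p ≈? x)) λ x y _ _ px py →
                ≈-trans (≈-sym (𝟙>0⇒ (σ p ≈? x) px)) (𝟙>0⇒ (σ p ≈? y) py))
             (λ px qx → ≈-trans px (≈-sym qx))) ⟩
      s * ∑[ p ∈ AA ] ∑[ q ∈ AA ] 𝟙 (σ p ≈? σ q)
        ≤⟨ *-monoʳ-≤ s sums≤differences ⟩
      s * E′ ∎
      where
      R′ : Carrier → ℕ
      R′ x = ∑[ p ∈ AA ] 𝟙 (σ p ≈? x)
      k²≤ : k * k ≤ ∑[ x ∈ S ] (1 * R′ x)
      k²≤ = begin
        k * k                                        ≡⟨ trans (sym (length-× A′ A′)) (length-as-∑ AA) ⟩
        ∑[ p ∈ AA ] 1                                ≤⟨ ∑-mono AA (λ (b , c) → any⇒∑≥1 _ (Any.map (λ {x} e → 𝟙≥1 (σ (b , c) ≈? x) e) (cover b c))) ⟩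
        ∑[ p ∈ AA ] ∑[ x ∈ S ] 𝟙 (σ p ≈? x)          ≡⟨ ∑-swap AA S _ ⟩
        ∑ S R′                                       ≡⟨ ∑-cong S (λ x → sym (*-identityˡ (R′ x))) ⟩
        ∑[ x ∈ S ] (1 * R′ x)                        ∎
      sums≤differences : ∑[ p ∈ AA ] ∑[ q ∈ AA ] 𝟙 (σ p ≈? σ q) ≤ E′
      sums≤differences = begin
        ∑[ p ∈ AA ] ∑[ q ∈ AA ] 𝟙 (σ p ≈? σ q)
          ≡⟨ trans (∑-× A′ A′ _) (∑-cong A′ λ b → ∑-cong A′ λ c → ∑-× A′ A′ _) ⟩
        ∑[ b ∈ A′ ] ∑[ c ∈ A′ ] ∑[ b′ ∈ A′ ] ∑[ c′ ∈ A′ ] 𝟙 (σ (b , c) ≈? σ (b′ , c′))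
          ≡⟨ ∑-cong A′ (λ b → trans (∑-swap A′ A′ _) (∑-cong A′ λ b′ → ∑-swap A′ A′ _)) ⟩
        ∑[ b ∈ A′ ] ∑[ b′ ∈ A′ ] ∑[ c′ ∈ A′ ] ∑[ c ∈ A′ ] 𝟙 (σ (b , c) ≈? σ (b′ , c′))
          ≤⟨ ∑-mono A′ (λ b → ∑-mono A′ λ b′ → ∑-mono A′ λ c′ → ∑-mono A′ λ c →
               𝟙≤ (σ (b , c) ≈? σ (b′ , c′)) λ e → 𝟙≥1 (a c′ ≈? a c ⊞ δ (b , b′)) (transfer b c b′ c′ e)) ⟩
        ∑[ b ∈ A′ ] ∑[ b′ ∈ A′ ] r′ (δ (b , b′))
          ≡⟨ ∑-× A′ A′ _ ⟨
        E′ ∎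
        where
        transfer : ∀ b c b′ c′ → a b ⊞ a c ≈ a b′ ⊞ a c′ → a c′ ≈ a c ⊞ (a b ⊟ a b′)
        transfer b c b′ c′ e = linear₂ (≈-sym e) (≈-sym (x⊟y⊞y≈x (a b) (a b′)))
          (⊞-solve 5 (λ b c b′ c′ z → c′ ⊕ ((b ⊕ c) ⊕ (z ⊕ b′)) ⊜ (c ⊕ z) ⊕ ((b′ ⊕ c′) ⊕ b)) ≈-refl
            (a b) (a c) (a b′) (a c′) (a b ⊟ a b′))

    module _ (τ : ℕ) (τ>0 : 0 < τ) where

      rich? : ∀ p → Dec (τ ≤ r′ (δ p))
      rich? p = τ ≤? r′ (δ p)

      W : List (Fin n × Fin n)
      W = filter rich? AA

      w : ℕ
      w = length W

      ∑W≤ : ∀ (f : Fin n × Fin n → ℕ) → ∑ W f ≤ ∑[ b ∈ I ] ∑[ c ∈ I ] f (b , c)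
      ∑W≤ f = ≤-trans (∑-filter-≤ rich? AA f) (∑AA≤ f)

      W-good : ∀ {b c} → (b , c) ∈ W → 4 * bad b ≤ n × 4 * bad c ≤ n
      W-good bc∈ = let (b∈ , c∈) = ∈-cartesianProduct⁻ A′ A′ (proj₁ (∈-filter⁻ rich? {xs = AA} bc∈)) in
        proj₂ (∈-filter⁻ good? {xs = I} b∈) , proj₂ (∈-filter⁻ good? {xs = I} c∈)

      τ²w≤E₃ : τ * τ * w ≤ E₃ convex
      τ²w≤E₃ = begin
        τ * τ * w                                        ≡⟨ trans (*-comm (τ * τ) w) (sym (∑-const W (τ * τ))) ⟩
        ∑[ _ ∈ W ] (τ * τ)                               ≤⟨ ∑-mono-∈ W (λ { (b , c) p∈ → *-mono-≤ (τ≤ρ p∈) (τ≤ρ p∈) }) ⟩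
        ∑[ (b , c) ∈ W ] (ρ convex b c * ρ convex b c)   ≤⟨ ∑W≤ _ ⟩
        E₃ convex                                        ∎
        where
        τ≤ρ : ∀ {b c} → (b , c) ∈ W → τ ≤ ρ convex b c
        τ≤ρ {b} {c} p∈ = ≤-trans (proj₂ (∈-filter⁻ rich? {xs = AA} p∈)) (r′≤reps (δ (b , c)))

      D : List Carrier
      D = dedup (map δ W)

      D-unique : Unique D
      D-unique = dedup-unique (map δ W)

      D-rich : ∀ {d} → d ∈ D → τ ≤ r′ d
      D-rich = All.lookup (All.deduplicate⁺ _≈?_ (All.map⁺ (All.all-filter rich? AA)))

      -- `D` lists only differences of rich pairs; τ > 0 supplies an actual representation of `z`,
      -- and that pair is itself rich.
      D-cover : ∀ {z} → τ ≤ r′ z → Any (z ≈_) D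
      D-cover {z} τ≤ =
        let (b , b∈ , pos)  = ∑>0⇒∃ A′ (≤-trans τ>0 τ≤)
            (c , c∈ , pos′) = ∑>0⇒∃ A′ pos
            z≈δ             = ≈-sym (≈⊞⇒⊟≈ (𝟙>0⇒ (a b ≈? a c ⊞ z) pos′))
        in dedup⁺ (lose (∈-map⁺ δ (∈-filter⁺ rich? (∈-cartesianProduct⁺ b∈ c∈) (≤-trans τ≤ (r′-resp z≈δ)))) z≈δ)

      -- Each d in `D` is the difference of at least τ pairs from `A′`; all of them are rich, and a
      -- pair has only one difference.
      |D|τ≤w : length D * τ ≤ w
      |D|τ≤w = begin
        length D * τ
          ≡⟨ ∑-const D τ ⟨
        ∑[ _ ∈ D ] τ
          ≤⟨ ∑-mono-∈ D (λ d d∈ → D-rich d∈) ⟩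
        ∑[ d ∈ D ] ∑[ b ∈ A′ ] ∑[ c ∈ A′ ] 𝟙 (a b ≈? a c ⊞ d)
          ≡⟨ trans (∑-swap D A′ _) (∑-cong A′ (λ b → ∑-swap D A′ _)) ⟩
        ∑[ b ∈ A′ ] ∑[ c ∈ A′ ] ∑[ d ∈ D ] 𝟙 (a b ≈? a c ⊞ d)
          ≤⟨ ∑-mono A′ (λ b → ∑-mono A′ λ c → ∑𝟙≤𝟙 (λ d → a b ≈? a c ⊞ d) (rich? (b , c)) D-unique
               (λ d d′ p p′ → ≈-trans (≈-sym (≈⊞⇒⊟≈ p)) (≈⊞⇒⊟≈ p′))
               (λ d d∈ p → ≤-trans (D-rich d∈) (r′-resp (≈-sym (≈⊞⇒⊟≈ p))))) ⟩
        ∑[ b ∈ A′ ] ∑[ c ∈ A′ ] 𝟙 (rich? (b , c))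
          ≡⟨ trans (sym (∑-× A′ A′ _)) (sym (length-filter-∑ rich? AA)) ⟩
        w ∎

      rich²? : ∀ ((x , y) : Carrier × Carrier) → Dec (τ ≤ r′ (x ⊟ y))
      rich²? (x , y) = τ ≤? r′ (x ⊟ y)

      PP : List (Carrier × Carrier)
      PP = cartesianProduct P P

      PP-rich : List (Carrier × Carrier)
      PP-rich = filter rich²? PP

      Q : ℕ
      Q = length PP-rich

      -- Popularity replaces `x` by its representations a i + a j. As x - y is some d in `D`, each
      -- gives a solution of a i + a j ≈ y + d, from which `x` is recovered.
      n²Q≤8sM : n * n * Q ≤ 8 * (s * mixed convex P D)
      n²Q≤8sM = begin
        n * n * Q
          ≡⟨ trans (*-comm (n * n) Q) (sym (∑-const PP-rich (n * n))) ⟩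
        ∑[ _ ∈ PP-rich ] (n * n)
          ≤⟨ ∑-mono-∈ PP-rich (λ { (x , y) p∈ → proj₂ (∈-filter⁻ popular? {xs = S} (proj₁ (∈-cartesianProduct⁻ P P (proj₁ (∈-filter⁻ rich²? {xs = PP} p∈))))) }) ⟩
        ∑[ (x , y) ∈ PP-rich ] (8 * (s * sums x))
          ≡⟨ trans (∑-*ˡ PP-rich 8 _) (cong (8 *_) (∑-*ˡ PP-rich s _)) ⟩
        8 * (s * ∑[ (x , y) ∈ PP-rich ] sums x)
          ≤⟨ *-monoʳ-≤ 8 (*-monoʳ-≤ s ∑sums≤) ⟩
        8 * (s * mixed convex P D) ∎
        where
        both? : ∀ x y i j → Dec (τ ≤ r′ (x ⊟ y) × a i ⊞ a j ≈ x)
        both? x y i j = rich²? (x , y) ×-dec (a i ⊞ a j ≈? x)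
        shifted? : ∀ j y i d → Dec (a i ≈ d ⊞ ⊟ (a j ⊟ y))
        shifted? j y i d = a i ≈? d ⊞ ⊟ (a j ⊟ y)
        shift : ∀ {x y i j d} → a i ⊞ a j ≈ x → x ⊟ y ≈ d → a i ≈ d ⊞ ⊟ (a j ⊟ y)
        shift {x} {y} {i} {j} {d} e e′ = ≈-sym (≈⊞⇒⊟≈ (linear₃
          (≈-trans (⊞-cong (≈-sym e′) ≈-refl) (x⊟y⊞y≈x x y)) (≈-sym e) (≈-sym (x⊟y⊞y≈x (a j) y))
          (⊞-solve 6 (λ d x i j z y → d ⊕ (x ⊕ ((i ⊕ j) ⊕ (z ⊕ y))) ⊜ (z ⊕ i) ⊕ ((d ⊕ y) ⊕ (x ⊕ j))) ≈-refl
            d x (a i) (a j) (a j ⊟ y) y)))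
        ∑sums≤ : ∑[ (x , y) ∈ PP-rich ] sums x ≤ mixed convex P D
        ∑sums≤ = begin
          ∑[ (x , y) ∈ PP-rich ] sums x
            ≡⟨ trans (∑-filter rich²? PP _) (∑-× P P _) ⟩
          ∑[ x ∈ P ] ∑[ y ∈ P ] (𝟙 (rich²? (x , y)) * sums x)
            ≤⟨ ∑-mono P (λ x → ∑-mono P λ y → 𝟙*≤ (rich²? (x , y)) λ rich → ∑-mono I λ i → ∑-mono I λ j →
                 𝟙≤ (a i ⊞ a j ≈? x) λ e → 𝟙≥1 (both? x y i j) (rich , e)) ⟩
          ∑[ x ∈ P ] ∑[ y ∈ P ] ∑[ i ∈ I ] ∑[ j ∈ I ] 𝟙 (both? x y i j)
            ≡⟨ ∑-swap₃ P P I I _ ⟩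
          ∑[ j ∈ I ] ∑[ x ∈ P ] ∑[ y ∈ P ] ∑[ i ∈ I ] 𝟙 (both? x y i j)
            ≡⟨ ∑-cong I (λ j → trans (∑-swap P P _) (∑-cong P λ y → ∑-swap P I _)) ⟩
          ∑[ j ∈ I ] ∑[ y ∈ P ] ∑[ i ∈ I ] ∑[ x ∈ P ] 𝟙 (both? x y i j)
            ≤⟨ ∑-mono I (λ j → ∑-mono P λ y → ∑-mono I λ i → ≤-trans
                 (∑𝟙≤𝟙 (λ x → both? x y i j) (any? (shifted? j y i) D) P-unique
                   (λ x x′ (_ , e) (_ , e′) → ≈-trans (≈-sym e) e′)
                   (λ x _ (rich , e) → Any.map (λ {d} → shift {x} {y} {i} {j} {d} e) (D-cover rich)))
                 (𝟙≤ (any? (shifted? j y i) D) λ any → any⇒∑≥1 _ (Any.map (λ {d} → 𝟙≥1 (shifted? j y i d)) any))) ⟩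
          ∑[ j ∈ I ] ∑[ y ∈ P ] reps D (⊟ (a j ⊟ y))
            ≡⟨ ∑-× I P _ ⟨
          mixed convex P D ∎

      -- A triple ((b , c) , i) is sent to (aᵢ + a_b , aᵢ + a_c); two triples collide when they have the same image.
      Triple : Set
      Triple = (Fin n × Fin n) × Fin n

      same? : ∀ i i′ b b′ → Dec (a i ⊞ a b ≈ a i′ ⊞ a b′)
      same? i i′ b b′ = a i ⊞ a b ≈? a i′ ⊞ a b′

      collide? : ∀ (p q : Triple) → Dec (_ × _)
      collide? ((b , c) , i) ((b′ , c′) , i′) = same? i i′ b b′ ×-dec same? i i′ c c′

      triples : List Triple
      triples = cartesianProduct W I

      ∑triples≤ : ∀ (f : Triple → ℕ) → ∑ triples f ≤ ∑[ i ∈ I ] ∑[ b ∈ I ] ∑[ c ∈ I ] f ((b , c) , i)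
      ∑triples≤ f = begin
        ∑ triples f                                        ≡⟨ ∑-× W I f ⟩
        ∑[ p ∈ W ] ∑[ i ∈ I ] f (p , i)                    ≡⟨ ∑-swap W I _ ⟩
        ∑[ i ∈ I ] ∑[ p ∈ W ] f (p , i)                    ≤⟨ ∑-mono I (λ i → ∑W≤ _) ⟩
        ∑[ i ∈ I ] ∑[ b ∈ I ] ∑[ c ∈ I ] f ((b , c) , i)   ∎

      ∑same≤ρ : ∀ i i′ → ∑[ b ∈ I ] ∑[ b′ ∈ I ] 𝟙 (same? i i′ b b′) ≤ ρ convex i i′
      ∑same≤ρ i i′ = begin
        ∑[ b ∈ I ] ∑[ b′ ∈ I ] 𝟙 (same? i i′ b b′)
          ≡⟨ ∑-swap I I _ ⟩
        ∑[ b′ ∈ I ] ∑[ b ∈ I ] 𝟙 (same? i i′ b b′)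
          ≤⟨ ∑-mono I (λ b′ → ∑-mono I λ b → 𝟙≤ (same? i i′ b b′) λ e →
               𝟙≥1 (a b′ ≈? a b ⊞ (a i ⊟ a i′)) (linear₂ (≈-sym e) (≈-sym (x⊟y⊞y≈x (a i) (a i′)))
                 (⊞-solve 5 (λ i b i′ b′ z → b′ ⊕ ((i ⊕ b) ⊕ (z ⊕ i′)) ⊜ (b ⊕ z) ⊕ ((i′ ⊕ b′) ⊕ i)) ≈-refl
                   (a i) (a b) (a i′) (a b′) (a i ⊟ a i′)))) ⟩
        ∑[ b′ ∈ I ] ∑[ b ∈ I ] 𝟙 (a b′ ≈? a b ⊞ (a i ⊟ a i′))
          ≡⟨ ∑-cong I (λ b′ → sym (∑-map I a _)) ⟩
        ρ convex i i′ ∎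

      -- For fixed i and i′ the conditions on (b , b′) and on (c , c′) are independent, and each has
      -- at most `ρ i i′` solutions.
      collisions≤E₃ : ∑[ p ∈ triples ] ∑[ q ∈ triples ] 𝟙 (collide? p q) ≤ E₃ convex
      collisions≤E₃ = begin
        ∑[ p ∈ triples ] ∑[ q ∈ triples ] 𝟙 (collide? p q)
          ≤⟨ ≤-trans (∑triples≤ _) (∑-mono I λ i → ∑-mono I λ b → ∑-mono I λ c → ∑triples≤ _) ⟩
        ∑[ i ∈ I ] ∑[ b ∈ I ] ∑[ c ∈ I ] ∑[ i′ ∈ I ] ∑[ b′ ∈ I ] ∑[ c′ ∈ I ] 𝟙 (same? i i′ b b′ ×-dec same? i i′ c c′)
          ≡⟨ ∑-cong I (λ i → trans (∑-cong I λ b → ∑-swap I I _) (∑-swap I I _)) ⟩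
        ∑[ i ∈ I ] ∑[ i′ ∈ I ] ∑[ b ∈ I ] ∑[ c ∈ I ] ∑[ b′ ∈ I ] ∑[ c′ ∈ I ] 𝟙 (same? i i′ b b′ ×-dec same? i i′ c c′)
          ≤⟨ ∑-mono I (λ i → ∑-mono I (factor i)) ⟩
        E₃ convex ∎
        where
        factor : ∀ i i′ → ∑[ b ∈ I ] ∑[ c ∈ I ] ∑[ b′ ∈ I ] ∑[ c′ ∈ I ] 𝟙 (same? i i′ b b′ ×-dec same? i i′ c c′)
                          ≤ ρ convex i i′ * ρ convex i i′
        factor i i′ = begin
          ∑[ b ∈ I ] ∑[ c ∈ I ] ∑[ b′ ∈ I ] ∑[ c′ ∈ I ] 𝟙 (same? i i′ b b′ ×-dec same? i i′ c c′)
            ≤⟨ ∑-mono I (λ b → ∑-mono I λ c → ∑-mono I λ b′ → ∑-mono I λ c′ →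
                 𝟙≤ (same? i i′ b b′ ×-dec same? i i′ c c′) λ (p , q) →
                   *-mono-≤ (𝟙≥1 (same? i i′ b b′) p) (𝟙≥1 (same? i i′ c c′) q)) ⟩
          ∑[ b ∈ I ] ∑[ c ∈ I ] ∑[ b′ ∈ I ] ∑[ c′ ∈ I ] (𝟙 (same? i i′ b b′) * 𝟙 (same? i i′ c c′))
            ≡⟨ ∑-cong I (λ b → ∑-cong I λ c → sym (∑*∑ I I _ _)) ⟩
          ∑[ b ∈ I ] ∑[ c ∈ I ] (∑[ b′ ∈ I ] 𝟙 (same? i i′ b b′) * ∑[ c′ ∈ I ] 𝟙 (same? i i′ c c′))
            ≡⟨ ∑*∑ I I _ _ ⟨
          ∑[ b ∈ I ] ∑[ b′ ∈ I ] 𝟙 (same? i i′ b b′) * ∑[ c ∈ I ] ∑[ c′ ∈ I ] 𝟙 (same? i i′ c c′)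
            ≤⟨ *-mono-≤ (∑same≤ρ i i′) (∑same≤ρ i i′) ⟩
          ρ convex i i′ * ρ convex i i′ ∎

      image? : ∀ (p : Triple) (t : Carrier × Carrier) → Dec (_ × _)
      image? ((b , c) , i) (x , y) = (a i ⊞ a b ≈? x) ×-dec (a i ⊞ a c ≈? y)

      image-functional : ∀ p → ∑[ t ∈ PP-rich ] 𝟙 (image? p t) ≤ 1
      image-functional p@((b , c) , i) = begin
        ∑[ t ∈ PP-rich ] 𝟙 (image? p t)                  ≤⟨ ∑-filter-≤ rich²? PP _ ⟩
        ∑[ t ∈ PP ] 𝟙 (image? p t)                       ≡⟨ ∑-× P P _ ⟩
        ∑[ x ∈ P ] ∑[ y ∈ P ] 𝟙 (image? p (x , y))       ≤⟨ ∑≤1 P-unique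
          (λ x _ → ∑≤1 P-unique (λ y _ → 𝟙≤1 (image? p (x , y))) λ y y′ _ _ q q′ →
            ≈-trans (≈-sym (proj₂ (𝟙>0⇒ (image? p (x , y)) q))) (proj₂ (𝟙>0⇒ (image? p (x , y′)) q′)))
          (λ x x′ _ _ q q′ → ≈-trans (≈-sym (first x q)) (first x′ q′)) ⟩
        1                                                ∎
        where
        first : ∀ x → 0 < ∑[ y ∈ P ] 𝟙 (image? p (x , y)) → a i ⊞ a b ≈ x
        first x pos = let (y , _ , q) = ∑>0⇒∃ P pos in proj₁ (𝟙>0⇒ (image? p (x , y)) q)

      ν : Carrier × Carrier → ℕ
      ν t = ∑[ p ∈ triples ] 𝟙 (image? p t)

      -- Adding a i to both members of a rich pair keeps the difference, and for at least half of
      -- the indices both sums are popular.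
      nw≤2∑ν : n * w ≤ 2 * ∑ PP-rich ν
      nw≤2∑ν = begin
        n * w
          ≡⟨ trans (*-comm n w) (sym (∑-const W n)) ⟩
        ∑[ _ ∈ W ] n
          ≤⟨ ∑-mono-∈ W (λ p p∈ → half p p∈) ⟩
        ∑[ p ∈ W ] (2 * ∑[ i ∈ I ] ∑[ t ∈ PP-rich ] 𝟙 (image? (p , i) t))
          ≡⟨ trans (∑-*ˡ W 2 _) (cong (2 *_) (trans (sym (∑-× W I _)) (∑-swap triples PP-rich _))) ⟩
        2 * ∑ PP-rich ν ∎
        where
        hit : ∀ p → p ∈ W → ∀ i → let (b , c) = p in
          1 ≤ ∑[ t ∈ PP-rich ] 𝟙 (image? (p , i) t) + (𝟙 (¬? (inP? (a i ⊞ a b))) + 𝟙 (¬? (inP? (a i ⊞ a c))))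
        hit (b , c) p∈ i = 1≤+𝟙¬+𝟙¬ (inP? (a i ⊞ a b)) (inP? (a i ⊞ a c)) λ x∈ y∈ →
          let (x , x∈P , e) = find x∈ ; (y , y∈P , e′) = find y∈ in
          ≤-trans (𝟙≥1 (image? ((b , c) , i) (x , y)) (e , e′))
            (term≤∑ (λ t → 𝟙 (image? ((b , c) , i) t)) (∈-filter⁺ rich²? (∈-cartesianProduct⁺ x∈P y∈P)
              (≤-trans (proj₂ (∈-filter⁻ rich? {xs = AA} p∈)) (r′-resp (δ≈ e e′)))))
          where
          δ≈ : ∀ {x y} → a i ⊞ a b ≈ x → a i ⊞ a c ≈ y → δ (b , c) ≈ x ⊟ y
          δ≈ {x} {y} e e′ = ≈⊞⇒⊟≈ (linear₃ e (≈-sym e′) (≈-sym (x⊟y⊞y≈x x y))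
            (⊞-solve 6 (λ b c i x y z → b ⊕ (x ⊕ ((i ⊕ c) ⊕ (z ⊕ y))) ⊜ (c ⊕ z) ⊕ ((i ⊕ b) ⊕ (y ⊕ x))) ≈-refl
              (a b) (a c) (a i) x y (x ⊟ y)))
        half : ∀ p → p ∈ W → n ≤ 2 * ∑[ i ∈ I ] ∑[ t ∈ PP-rich ] 𝟙 (image? (p , i) t)
        half p@(b , c) p∈ = *-cancelˡ-≤ 2 (+-cancelʳ-≤ (n + n) _ _ (begin
          2 * n + (n + n)
            ≡⟨ four n ⟩
          4 * n
            ≤⟨ *-monoʳ-≤ 4 n≤ ⟩
          4 * (h + (bad b + bad c))
            ≡⟨ regroup h (bad b) (bad c) ⟩
          2 * (2 * h) + (4 * bad b + 4 * bad c)
            ≤⟨ +-monoʳ-≤ (2 * (2 * h)) (+-mono-≤ (proj₁ (W-good p∈)) (proj₂ (W-good p∈))) ⟩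
          2 * (2 * h) + (n + n) ∎))
          where
          h : ℕ
          h = ∑[ i ∈ I ] ∑[ t ∈ PP-rich ] 𝟙 (image? (p , i) t)
          four : ∀ n → 2 * n + (n + n) ≡ 4 * n
          four = solve-∀
          regroup : ∀ h x y → 4 * (h + (x + y)) ≡ 2 * (2 * h) + (4 * x + 4 * y)
          regroup = solve-∀
          n≤ : n ≤ h + (bad b + bad c)
          n≤ = begin
            n               ≡⟨ trans (sym |I|) (length-as-∑ I) ⟩
            ∑[ i ∈ I ] 1    ≤⟨ ∑-mono I (hit p p∈) ⟩
            ∑[ i ∈ I ] (∑[ t ∈ PP-rich ] 𝟙 (image? (p , i) t) + (𝟙 (¬? (inP? (a i ⊞ a b))) + 𝟙 (¬? (inP? (a i ⊞ a c)))))
                            ≡⟨ trans (∑-+ I _ _) (cong (h +_) (∑-+ I _ _)) ⟩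
            h + (bad b + bad c) ∎

      -- Cauchy-Schwarz over the Q possible images; the second moment of `ν` is at most the number
      -- of collisions.
      n²w²≤4QE₃ : n * n * (w * w) ≤ 4 * (Q * E₃ convex)
      n²w²≤4QE₃ = begin
        n * n * (w * w)
          ≡⟨ regroup₁ n w ⟩
        n * w * (n * w)
          ≤⟨ *-mono-≤ nw≤2∑ν nw≤2∑ν ⟩
        2 * ∑ PP-rich ν * (2 * ∑ PP-rich ν)
          ≡⟨ regroup₂ (∑ PP-rich ν) ⟩
        4 * (∑ PP-rich ν * ∑ PP-rich ν)
          ≡⟨ cong (λ z → 4 * (z * z)) (∑-cong PP-rich (λ t → sym (*-identityˡ (ν t)))) ⟩
        4 * (∑[ t ∈ PP-rich ] (1 * ν t) * ∑[ t ∈ PP-rich ] (1 * ν t))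
          ≤⟨ *-monoʳ-≤ 4 (cauchySchwarz PP-rich (λ _ → 1) ν) ⟩
        4 * (∑[ t ∈ PP-rich ] 1 * ∑[ t ∈ PP-rich ] (ν t * ν t))
          ≤⟨ *-monoʳ-≤ 4 (*-mono-≤ (≤-reflexive (sym (length-as-∑ PP-rich)))
               (≤-trans (∑-collisions triples PP-rich image? collide? image-functional
                          (λ (p , p′) (q , q′) → ≈-trans p (≈-sym q) , ≈-trans p′ (≈-sym q′)))
                        collisions≤E₃)) ⟩
        4 * (Q * E₃ convex) ∎
        where
        regroup₁ : ∀ n w → n * n * (w * w) ≡ n * w * (n * w)
        regroup₁ = solve-∀
        regroup₂ : ∀ x → 2 * x * (2 * x) ≡ 4 * (x * x)
        regroup₂ = solve-∀

    sumset-bound : ∀ l → 0 < l → n < 2 ^ l → n ^ 30 ≤ K ^ 38 * l ^ 29 * s ^ 19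
    sumset-bound l 0<l n<2^l =
      n³⁰≤ K n l s τ (w τ τ>0) (Q τ τ>0) (mixed convex P (D τ τ>0)) (E₃ convex)
        u v m (length (D τ τ>0)) {{n≢0}} {{>-nonZero w>0}}
        energy (τ²w≤E₃ τ τ>0) (E₃≤ convex l n<2^l)
        (≤-trans (n²w²≤4QE₃ τ τ>0) (*-monoˡ-≤ _ (≤-trans (m≤m+n 4 28) 32≤K)))
        (≤-trans (n²Q≤8sM τ τ>0) (*-monoˡ-≤ _ (≤-trans (m≤m+n 8 24) 32≤K)))
        (≤-trans mixed≤ (*-monoˡ-≤ _ (≤-trans (m≤m+n 4 28) 32≤K)))
        (≤-trans mu³≤ (*-mono-≤ C≤K (*-monoʳ-≤ n (*-mono-≤ |P|≤s |P|≤s))))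
        mv≤ (≤-trans mv³≤ (*-monoˡ-≤ _ C≤K)) (|D|τ≤w τ τ>0)
      where
      weight : ℕ → ℕ
      -- Bounds the part of `E′` with 2 ^ j ≤ r′ < 2 ^ (j + 1); the level τ is chosen to maximise
      -- it.
      weight j = w (2 ^ j) (m^n>0 2 j) * (2 * 2 ^ j)
      E′≤ : E′ ≤ ∑ (upTo l) weight
      E′≤ = begin
        ∑[ p ∈ AA ] r′ (δ p)
          ≡⟨ ∑-cong AA (λ p → sym (*-identityʳ _)) ⟩
        ∑[ p ∈ AA ] (r′ (δ p) ^ 1)
          ≤⟨ ∑-mono AA (λ p → dyadic l 0 (r′ (δ p)) (≤-<-trans (≤-trans (r′≤reps (δ p)) (reps≤n (A-unique convex) (δ p))) n<2^l)) ⟩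
        ∑[ p ∈ AA ] ∑[ j ∈ upTo l ] (𝟙 (2 ^ j ≤? r′ (δ p)) * (2 ^ suc j) ^ 1)
          ≡⟨ ∑-swap AA (upTo l) _ ⟩
        ∑[ j ∈ upTo l ] ∑[ p ∈ AA ] (𝟙 (2 ^ j ≤? r′ (δ p)) * (2 ^ suc j) ^ 1)
          ≡⟨ ∑-cong (upTo l) (λ j → trans (∑-*ʳ AA _ _)
               (cong₂ _*_ (sym (length-filter-∑ (λ p → 2 ^ j ≤? r′ (δ p)) AA)) (*-identityʳ (2 * 2 ^ j)))) ⟩
        ∑ (upTo l) weight ∎
      best : ∃ λ j → j ∈ upTo l × ∑ (upTo l) weight ≤ length (upTo l) * weight j
      best = ∑≤length*max (upTo l) weight (subst (0 <_) (sym (length-upTo l)) 0<l)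
      τ : ℕ
      τ = 2 ^ proj₁ best
      τ>0 : 0 < τ
      τ>0 = m^n>0 2 (proj₁ best)
      energy : n ^ 4 ≤ K * (l * s * (τ * w τ τ>0))
      energy = begin
        -- The factor 32 is 2⁴ from n ≤ 2k times 2 from dyadic rounding.
        n ^ 4                                           ≤⟨ ^-monoˡ-≤ 4 n≤2k ⟩
        (2 * k) ^ 4                                     ≡⟨ regroup₁ k ⟩
        16 * (k * k * (k * k))                          ≤⟨ *-monoʳ-≤ 16 k⁴≤sE′ ⟩
        16 * (s * E′)                                   ≤⟨ *-monoʳ-≤ 16 (*-monoʳ-≤ s (≤-trans E′≤ (proj₂ (proj₂ best)))) ⟩
        16 * (s * (length (upTo l) * weight (proj₁ best)))
          ≡⟨ cong (λ z → 16 * (s * (z * weight (proj₁ best)))) (length-upTo l) ⟩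
        16 * (s * (l * (w τ τ>0 * (2 * τ))))            ≡⟨ regroup₂ s l (w τ τ>0) τ ⟩
        32 * (l * s * (τ * w τ τ>0))                    ≤⟨ *-monoˡ-≤ (l * s * (τ * w τ τ>0)) 32≤K ⟩
        K * (l * s * (τ * w τ τ>0))                     ∎
        where
        regroup₁ : ∀ k → 2 * k * (2 * k * (2 * k * (2 * k * 1))) ≡ 16 * (k * k * (k * k))
        regroup₁ = solve-∀
        regroup₂ : ∀ s l w t → 16 * (s * (l * (w * (2 * t)))) ≡ 32 * (l * s * (t * w))
        regroup₂ = solve-∀
      w>0 : 0 < w τ τ>0
      w>0 = n≢0⇒n>0 λ w≡0 → <⇒≱ (m^n>0 n 4) (≤-trans energy (≤-reflexive
        (trans (cong (λ z → K * (l * s * (τ * z))) w≡0) (vanish K (l * s) τ))))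
        where
        vanish : ∀ a b c → a * (b * (c * 0)) ≡ 0
        vanish = solve-∀
      |P|≤s : length P ≤ s
      |P|≤s = length-filter popular? S
      open DyadicLevel (∃-level convex P-unique (D-unique τ τ>0) l 0<l n<2^l)

-- The exponent 30/19 - 1/(k + 1), cleared of denominators; `N` is chosen before the set, which
-- makes the o(1) uniform. `L` is any list that contains all sums up to `≈`, so removing its
-- repetitions reduces to `sumset-bound`.
theorem1p4 : (R : RealField 0ℓ 0ℓ) → (k : ℕ) →
    Σ ℕ (λ N → (n : ℕ) → N ≤ n → (a : Fin n → RealField.Carrier R) → Convex R n a →
    (L : List (RealField.Carrier R)) →
    ((i j : Fin n) → Any (λ x → RealField._≈_ R (RealField._+_ R (a i) (a j)) x) L) →
    n ^ (30 * suc k ∸ 19) ≤ length L ^ (19 * suc k))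
theorem1p4 R k = let (N , N>0 , absorb) = absorb-logarithm (K ^ 38) k in
  N , λ n N≤n a convex L cover →
    ≤-trans (absorb n (length (dedup L)) N≤n
               (sumset-bound convex (≤-trans N>0 N≤n) (dedup-unique L) (λ i j → dedup⁺ (cover i j))))
            (^-monoˡ-≤ (19 * suc k) (length-deduplicate _≈?_ L))
  where
  open Sumsets R using (_≈?_)
  open Energy R using (dedup; dedup-unique; dedup⁺)
  open PopularSums R using (sumset-bound)
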